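{- Let $\mathcal{H}$ be an LSH family on $\mathbb{R}^d$ (possibly of infinite range) with collision probability $k(x,y)=\Pr_{h\sim\mathcal{H}}[h(x)=h(y)]$, fix an integer $p\ge1$ and an integer $R\ge 2$. Let $h$ be the concatenation of $p$ independent draws from $\mathcal{H}$, let $g$ be a uniformly random function from the range of $h$ to $\{1,\dots,R\}$, independent of $h$, and set $\bar h=g\circ h$. Let $\mathcal{D}\subset\mathbb{R}^d$ with $N=|\mathcal{D}|$, and let $A$ be the array of $R$ counters with $A[j]=|\{x\in\mathcal{D}:\bar h(x)=j\}|$. For a query $q$ define $$\widehat K(q)=\left(\frac{A[\bar h(q)]}{N}-\frac1R\right)\frac{R}{R-1}.$$ Then $\mathbb{E}[\widehat K(q)]=K(q)$ and $$\operatorname{Var}(\widehat K(q))\le\left(\frac{R}{R-1}\right)^2\left(\sqrt{\frac{R-1}{R}}\,\widetilde K(q)+\frac{1}{\sqrt R}\right)^2 .$$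
   Context: Here $K(q)=\frac1N\sum_{x\in\mathcal{D}}k^p(x,q)$ and $\widetilde K(q)=\frac1N\sum_{x\in\mathcal{D}}k^{p/2}(x,q)$. Under this construction $\Pr[\bar h(x)=\bar h(q)]=k^p(x,q)\frac{R-1}{R}+\frac1R$. -}

module Defs where

open import Level using (0ℓ) renaming (suc to lsuc)
open import Algebra.Bundles using (CommutativeRing; Semiring)
import Algebra.Definitions.RawMonoid as RawMonoidDefs
import Algebra.Definitions.RawSemiring as RawSemiringDefs
import Algebra.Properties.Ring as RingProperties
open import Data.Fin.Base using (Fin; toℕ)
import Data.Fin.Properties as Fin
open import Data.List.Base as List using (List; length; filter)
open import Data.Nat.Base as ℕ using (ℕ)
open import Data.Product.Base using (∃-syntax; _×_; _,_; proj₁; proj₂)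
open import Data.Sum.Base using (_⊎_; inj₁; inj₂)
open import Data.Vec.Base as Vec using (Vec)
open import Data.Vec.Functional using (Vector)
import Data.Vec.Functional.Relation.Binary.Equality.Setoid as VectorEquality
open import Function.Base using (_∘_)
open import Function.Bundles using (Func; _⟨$⟩_)
open import Function.Definitions using (Injective)
open import Relation.Binary.Bundles using (Setoid)
open import Relation.Binary.Core using (Rel)
open import Relation.Binary.PropositionalEquality as ≡ using (_≡_)
open import Relation.Binary.Structures using (IsTotalOrder)
open import Relation.Nullary.Negation.Core using (¬_)
open import Relation.Unary using (Pred; _≐_; ∁; U; ⋃; Satisfiable)

------------------------------------------------------------------------
-- The real numbers

-- The library has no real numbers.  They are taken to be an arbitrary
-- complete ordered field, which classically is ℝ up to unique isomorphism.
-- The value of 0# ⁻¹ is unspecified.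

record CompleteOrderedField : Set₁ where
  infix  4 _≤_
  infix  8 _⁻¹
  infixl 7 _/_

  field
    commutativeRing : CommutativeRing 0ℓ 0ℓ
  open CommutativeRing commutativeRing public

  field
    _≤_          : Rel Carrier 0ℓ
    isTotalOrder : IsTotalOrder _≈_ _≤_
    0≉1          : ¬ (0# ≈ 1#)
    _⁻¹          : Carrier → Carrier
    *-inverseʳ   : ∀ x → ¬ (x ≈ 0#) → x * x ⁻¹ ≈ 1#
    +-monoˡ-≤    : ∀ z {x y} → x ≤ y → x + z ≤ y + z
    *-nonneg     : ∀ {x y} → 0# ≤ x → 0# ≤ y → 0# ≤ x * y

  IsUpperBound : Pred Carrier 0ℓ → Carrier → Set
  IsUpperBound S b = ∀ x → S x → x ≤ b

  IsLeastUpperBound : Pred Carrier 0ℓ → Carrier → Set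
  IsLeastUpperBound S s = IsUpperBound S s × (∀ b → IsUpperBound S b → s ≤ b)

  field
    complete : (S : Pred Carrier 0ℓ) → Satisfiable S → ∃[ b ] IsUpperBound S b →
               ∃[ s ] IsLeastUpperBound S s

  open IsTotalOrder isTotalOrder public using (total; ≤-respˡ-≈; ≤-respʳ-≈)
    renaming ( refl to ≤-refl; trans to ≤-trans; antisym to ≤-antisym; reflexive to ≤-reflexive )

  open RawSemiringDefs (Semiring.rawSemiring semiring) public using (_^_; sum)
  open RawSemiringDefs (Semiring.rawSemiring semiring) using () renaming (_×_ to _·_)
  open RawMonoidDefs (Semiring.*-rawMonoid semiring) public using () renaming (sum to product)

  fromℕ : ℕ → Carrier
  fromℕ n = n · 1#

  _/_ : Carrier → Carrier → Carrier
  x / y = x * y ⁻¹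

  private
    module R = RingProperties ring

    0≤y-x : ∀ {x y} → x ≤ y → 0# ≤ y - x
    0≤y-x {x} x≤y = ≤-respˡ-≈ (-‿inverseʳ x) (+-monoˡ-≤ (- x) x≤y)

    0≤1 : 0# ≤ 1#
    0≤1 with total 0# 1#
    ... | inj₁ p = p
    ... | inj₂ p = ≤-respʳ-≈ -1*-1≈1 (*-nonneg 0≤-1 0≤-1)
      where
      0≤-1 : 0# ≤ - 1#
      0≤-1 = ≤-respʳ-≈ (+-identityˡ (- 1#)) (0≤y-x p)
      -1*-1≈1 : - 1# * - 1# ≈ 1#
      -1*-1≈1 = trans (R.-1*x≈-x (- 1#)) (R.-‿involutive 1#)

    1≤y⇒y≤y*y : ∀ {y} → 1# ≤ y → y ≤ y * y
    1≤y⇒y≤y*y {y} 1≤y =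
      ≤-respˡ-≈ (+-identityˡ y) (≤-respʳ-≈ eq (+-monoˡ-≤ y
        (*-nonneg (≤-trans 0≤1 1≤y) (0≤y-x 1≤y))))
      where
      eq : y * (y - 1#) + y ≈ y * y
      eq = trans (+-congˡ (sym (*-identityʳ y)))
          (trans (sym (distribˡ y (y - 1#) 1#))
                 (*-congˡ (trans (+-assoc y (- 1#) 1#)
                   (trans (+-congˡ (-‿inverseˡ 1#)) (+-identityʳ y)))))

  -- √ x = sup { y | y ≤ 0 or y² ≤ x }: the square root for 0 ≤ x, and 0
  -- for x < 0.

  SqrtSet : Carrier → Pred Carrier 0ℓ
  SqrtSet x y = y ≤ 0# ⊎ y * y ≤ x

  sqrtSet-bounded : ∀ x → ∃[ b ] IsUpperBound (SqrtSet x) b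
  sqrtSet-bounded x with total 1# x
  ... | inj₁ 1≤x = x , bound
    where
    bound : IsUpperBound (SqrtSet x) x
    bound y (inj₁ y≤0) = ≤-trans y≤0 (≤-trans 0≤1 1≤x)
    bound y (inj₂ y²≤x) with total y x
    ... | inj₁ y≤x = y≤x
    ... | inj₂ x≤y = ≤-trans (1≤y⇒y≤y*y (≤-trans 1≤x x≤y)) y²≤x
  ... | inj₂ x≤1 = 1# , bound
    where
    bound : IsUpperBound (SqrtSet x) 1#
    bound y (inj₁ y≤0) = ≤-trans y≤0 0≤1
    bound y (inj₂ y²≤x) with total y 1#
    ... | inj₁ y≤1 = y≤1
    ... | inj₂ 1≤y = ≤-trans (1≤y⇒y≤y*y 1≤y) (≤-trans y²≤x x≤1)

  √ : Carrier → Carrier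
  √ x = proj₁ (complete (SqrtSet x) (0# , inj₁ ≤-refl) (sqrtSet-bounded x))

module Real (ℝ : CompleteOrderedField) where
  open CompleteOrderedField ℝ

  ----------------------------------------------------------------------
  -- Probability

  -- ℙ is only constrained on measurable events; its values on other
  -- predicates are junk.

  record ProbabilitySpace : Set₂ where
    field
      Ω          : Set
      Measurable : Pred Ω 0ℓ → Set₁
      ℙ          : Pred Ω 0ℓ → Carrier

      measurable-resp : ∀ {A B} → A ≐ B → Measurable A → Measurable B
      measurable-U    : Measurable U
      measurable-∁    : ∀ {A} → Measurable A → Measurable (∁ A)
      measurable-⋃    : (A : ℕ → Pred Ω 0ℓ) → (∀ n → Measurable (A n)) →
                        Measurable (⋃ ℕ A)

      ℙ-cong   : ∀ {A B} → Measurable A → A ≐ B → ℙ A ≈ ℙ B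
      ℙ-nonneg : ∀ {A} → Measurable A → 0# ≤ ℙ A
      ℙ-U      : ℙ U ≈ 1#
      -- Countable additivity: a series of nonnegative terms converges to
      -- the least upper bound of its partial sums.
      ℙ-⋃      : (A : ℕ → Pred Ω 0ℓ) → (∀ n → Measurable (A n)) →
                 (∀ m n ω → A m ω → A n ω → m ≡ n) →
                 IsLeastUpperBound
                   (λ s → ∃[ n ] s ≈ sum {n} (λ i → ℙ (A (toℕ i))))
                   (ℙ (⋃ ℕ A))

  -- `Expectation 𝒫 X e` says that X is a simple random variable (it is
  -- constant on each cell of a finite measurable partition) with
  -- expectation e.  Every random variable considered here takes finitely
  -- many values, so no more general integral is required.

  record Expectation (𝒫 : ProbabilitySpace)
                     (X : ProbabilitySpace.Ω 𝒫 → Carrier) (e : Carrier) : Set₁ where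
    open ProbabilitySpace 𝒫
    field
      size            : ℕ
      cell            : Ω → Fin size
      cell-measurable : ∀ i → Measurable (λ ω → cell ω ≡ i)
      value           : Fin size → Carrier
      X≈value         : ∀ ω → X ω ≈ value (cell ω)
      e≈sum           : e ≈ sum (λ i → value i * ℙ (λ ω → cell ω ≡ i))

  -- Expectation of X(ω₁ , ω₂) for independent ω₁ and ω₂, as the iterated
  -- integral ∫ (∫ X(ω₁ , ω₂) dω₂) dω₁.

  Expectation₂ : (𝒫₁ 𝒫₂ : ProbabilitySpace) →
                 (ProbabilitySpace.Ω 𝒫₁ → ProbabilitySpace.Ω 𝒫₂ → Carrier) →
                 Carrier → Set₁
  Expectation₂ 𝒫₁ 𝒫₂ X e =
    ∃[ Y ] (∀ ω₁ → Expectation 𝒫₂ (X ω₁) (Y ω₁)) × Expectation 𝒫₁ Y e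

  Variance₂ : (𝒫₁ 𝒫₂ : ProbabilitySpace) →
              (ProbabilitySpace.Ω 𝒫₁ → ProbabilitySpace.Ω 𝒫₂ → Carrier) →
              Carrier → Set₁
  Variance₂ 𝒫₁ 𝒫₂ X v =
    ∃[ μ ] Expectation₂ 𝒫₁ 𝒫₂ X μ ×
           Expectation₂ 𝒫₁ 𝒫₂ (λ ω₁ ω₂ → (X ω₁ ω₂ - μ) ^ 2) v

  ----------------------------------------------------------------------
  -- Locality-sensitive hashing

  pointSetoid : ℕ → Setoid 0ℓ 0ℓ
  pointSetoid d = VectorEquality.≋-setoid setoid d

  Point : ℕ → Set
  Point d = Setoid.Carrier (pointSetoid d)

  -- A random hash function h : ℝᵈ → S.  The family is indexed by the sample
  -- space; the collision probabilities are required to make sense.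

  record LSHFamily (d : ℕ) (S : Set) : Set₂ where
    field
      space : ProbabilitySpace
    open ProbabilitySpace space public
    field
      hash : Ω → Func (pointSetoid d) (≡.setoid S)

    Collision : Point d → Point d → Pred Ω 0ℓ
    Collision x y θ = hash θ ⟨$⟩ x ≡ hash θ ⟨$⟩ y

    field
      collision-measurable : ∀ x y → Measurable (Collision x y)

    k : Point d → Point d → Carrier
    k x y = ℙ (Collision x y)

  record IndependentDraws {d : ℕ} {S : Set} (ℋ : LSHFamily d S) (p : ℕ) : Set₂ where
    private module ℋ = LSHFamily ℋ
    field
      space : ProbabilitySpace
    open ProbabilitySpace space public
    field
      draw            : Fin p → Ω → ℋ.Ω
      draw-measurable : ∀ i {B} → ℋ.Measurable B → Measurable (B ∘ draw i)
      draw-law        : ∀ i {B} → ℋ.Measurable B → ℙ (B ∘ draw i) ≈ ℋ.ℙ B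
      independent     : (B : Fin p → Pred ℋ.Ω 0ℓ) → (∀ i → ℋ.Measurable (B i)) →
                        ℙ (λ ω → ∀ i → B i (draw i ω)) ≈
                        product (λ i → ℙ (B i ∘ draw i))

    concatenation : Ω → Point d → Vec S p
    concatenation ω x = Vec.tabulate (λ i → ℋ.hash (draw i ω) ⟨$⟩ x)

  -- For infinite T the uniform distribution on T → Fin R is given by its
  -- finite-dimensional marginals: the values at distinct points are
  -- independent and uniform on Fin R.

  record UniformRandomFunction (T : Set) (R : ℕ) : Set₂ where
    field
      space : ProbabilitySpace
    open ProbabilitySpace space public
    field
      function            : Ω → T → Fin R
      function-measurable : ∀ t j → Measurable (λ ω → function ω t ≡ j)
      uniform             : ∀ {m} (t : Vector T m) (j : Vector (Fin R) m) →
                            Injective _≡_ _≡_ t →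
                            ℙ (λ ω → ∀ i → function ω (t i) ≡ j i) ≈
                            (1# / fromℕ R) ^ m

  module Estimator
    {d : ℕ} {S : Set} (ℋ : LSHFamily d S) {p R : ℕ}
    (h : IndependentDraws ℋ p) (g : UniformRandomFunction (Vec S p) R)
    (D : List (Point d))
    where

    open LSHFamily ℋ using (k)
    private
      module h = IndependentDraws h
      module g = UniformRandomFunction g

    N r : Carrier
    N = fromℕ (length D)
    r = fromℕ R

    Σ[x∈D] : (Point d → Carrier) → Carrier
    Σ[x∈D] f = List.foldr _+_ 0# (List.map f D)

    K : Point d → Carrier
    K q = (1# / N) * Σ[x∈D] (λ x → k x q ^ p)

    -- k^(p/2) is (√ k)^p.
    K̃ : Point d → Carrier
    K̃ q = (1# / N) * Σ[x∈D] (λ x → √ (k x q) ^ p)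

    h̄ : h.Ω → g.Ω → Point d → Fin R
    h̄ ω₁ ω₂ x = g.function ω₂ (h.concatenation ω₁ x)

    A : h.Ω → g.Ω → Fin R → ℕ
    A ω₁ ω₂ j = length (filter (λ x → h̄ ω₁ ω₂ x Fin.≟ j) D)

    K̂ : Point d → h.Ω → g.Ω → Carrier
    K̂ q ω₁ ω₂ = (fromℕ (A ω₁ ω₂ (h̄ ω₁ ω₂ q)) / N - 1# / r) * (r / (r - 1#))

    -- g is independent of h, so the joint law is the iterated one.  For
    -- uncountable S the map (g , s) ↦ g s need not be jointly measurable;
    -- the iterated integral still makes sense.
    𝔼 𝕍ar : (h.Ω → g.Ω → Carrier) → Carrier → Set₁
    𝔼   = Expectation₂ h.space g.space
    𝕍ar = Variance₂ h.space g.space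

-- Write ι = 1/R and let W_x = 1[h̄ x = h̄ q] - ι, so that K̂ is a multiple of
-- ∑ W_x.  Given h, the mean of W_x is (1 - ι) 1[h x = h q], and the mean of
-- W_x W_y is (1 - ι)² if h x = h y = h q, ι (1 - ι) if h x = h y ≠ h q, and 0
-- otherwise.  The variance is at most the second moment; there the first case
-- has probability at most k(x,q)^(p/2) k(y,q)^(p/2), giving the K̃² term, and the
-- second case is bounded by ι, giving the 1/R term.  The cross term in the
-- square on the right-hand side is slack.

module Submission where

open import Defs
open import Level using (0ℓ)
open import Algebra.Bundles using (CommutativeRing)
import Algebra.Properties.AbelianGroup as AbelianGroupProperties
import Algebra.Properties.Monoid.Sum as MonoidSum
import Algebra.Properties.Ring as RingProperties
import Algebra.Properties.Semiring.Mult.TCOptimised as SemiringMult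
import Algebra.Properties.Semiring.Sum as SemiringSum
import Algebra.Solver.Ring as RingSolver
open import Algebra.Solver.Ring.AlmostCommutativeRing using (_-Raw-AlmostCommutative⟶_; fromCommutativeRing)
open import Axiom.ExcludedMiddle using (ExcludedMiddle)
open import Data.Fin.Base using (Fin; toℕ; combine; remQuot; _↑ˡ_; _↑ʳ_)
open import Data.Fin.Patterns using (0F; 1F; 2F)
import Data.Fin.Properties as Fin
open import Data.Integer.Base as ℤ using (ℤ; +_; -[1+_]; +0; +[1+_]; _⊖_; _◃_)
import Data.Integer.Properties as ℤ
open import Data.List.Base as List using (List; []; _∷_; length; filter)
open import Data.List.Relation.Unary.Unique.Setoid using (Unique)
open import Data.Maybe.Base using (Maybe; just; nothing)
open import Data.Nat.Base as ℕ using (ℕ; zero; suc)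
import Data.Nat.Properties as ℕ
open import Data.Product.Base using (_×_; ∃-syntax; _,_; proj₁; proj₂)
open import Data.Sign.Base as Sign using (Sign)
open import Data.Sum.Base using (inj₁; inj₂)
open import Data.Vec.Base as Vec using (Vec)
open import Data.Vec.Properties using (lookup∘tabulate; tabulate-cong)
open import Function.Base using (_∘_)
open import Function.Bundles using (_⟨$⟩_)
open import Function.Definitions using (Injective)
open import Relation.Binary.Bundles using (Poset)
open import Relation.Binary.PropositionalEquality as ≡ using (_≡_; _≢_)
import Relation.Binary.Reasoning.PartialOrder as PartialOrderReasoning
import Relation.Binary.Reasoning.Setoid as SetoidReasoning
open import Relation.Binary.Structures using (IsTotalOrder)
open import Relation.Nullary using (¬_; Dec; yes; no; contradiction)
open import Relation.Unary using (Pred; _≐_; _∩_; _∪_; ∁; ∅; U; ⋃; _⊆_)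

-- The two sources of randomness are never merged into one law: `g` is integrated first, with `h`
-- frozen. This works because a frozen `h` enters the means over `g` only through the coincidences
-- among its values at `x`, `y` and `q`. The inner means are therefore combinations of indicators of
-- collision events of `h`, whose measurability and probabilities come from the family; no other
-- event about values in `S`, which may be infinite, has to be measured. The centring constant `ι`
-- is the chance that `g` merges two distinct values. It gives W_x mean zero as soon as `h`
-- separates `x` from `q`, and since the mergers of two distinct values with a third one are
-- independent, the products of deviations average out as well. What survives in the mean carries a
-- factor 1 - ι, and undoing it is the origin of R/(R - 1).

-- Integer coefficients let the ring solver cancel x - x; with coefficients
-- in the ring itself it could not decide that 1# - 1# vanishes.
module IntegerRingSolver (R : CommutativeRing 0ℓ 0ℓ) where
  open CommutativeRing R
  open RingProperties ring
  open AbelianGroupProperties +-abelianGroup using (⁻¹-∙-comm)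
  open SemiringMult semiring using (1+×; ×-homo-+; ×1-homo-*) renaming (_×_ to _·_)
  open SetoidReasoning setoid

  -- The optimised multiple reduces `1 · 1#` to `1#`, so that `con (+ 1)` in a solved equation is
  -- `1#` itself and not `1# + 0#`.
  ⟦_⟧ : ℤ → Carrier
  ⟦ + n      ⟧ = n · 1#
  ⟦ -[1+ n ] ⟧ = - (suc n · 1#)

  cancel-+ : ∀ x y z → (x + y) - (x + z) ≈ y - z
  cancel-+ x y z = begin
    (x + y) - (x + z)     ≈⟨ +-congˡ (⁻¹-∙-comm x z) ⟨
    (x + y) + (- x - z)   ≈⟨ +-congʳ (+-comm x y) ⟩
    (y + x) + (- x - z)   ≈⟨ +-assoc y x _ ⟩
    y + (x + (- x - z))   ≈⟨ +-congˡ (+-assoc x (- x) (- z)) ⟨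
    y + ((x - x) - z)     ≈⟨ +-congˡ (+-congʳ (-‿inverseʳ x)) ⟩
    y + (0# - z)          ≈⟨ +-congˡ (+-identityˡ _) ⟩
    y - z                 ∎

  ⟦⊖⟧ : ∀ m n → ⟦ m ⊖ n ⟧ ≈ m · 1# - n · 1#
  ⟦⊖⟧ zero    zero    = sym (-‿inverseʳ 0#)
  ⟦⊖⟧ zero    (suc n) = sym (+-identityˡ _)
  ⟦⊖⟧ (suc m) zero    = sym (trans (+-congˡ -0#≈0#) (+-identityʳ _))
  ⟦⊖⟧ (suc m) (suc n) = begin
    ⟦ suc m ⊖ suc n ⟧                ≡⟨ ≡.cong ⟦_⟧ (ℤ.[1+m]⊖[1+n]≡m⊖n m n) ⟩
    ⟦ m ⊖ n ⟧                        ≈⟨ ⟦⊖⟧ m n ⟩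
    m · 1# - n · 1#                  ≈⟨ cancel-+ 1# (m · 1#) (n · 1#) ⟨
    (1# + m · 1#) - (1# + n · 1#)    ≈⟨ +-cong (1+× m 1#) (-‿cong (1+× n 1#)) ⟨
    suc m · 1# - suc n · 1#          ∎

  ⟦+◃⟧ : ∀ n → ⟦ Sign.+ ◃ n ⟧ ≈ n · 1#
  ⟦+◃⟧ zero    = refl
  ⟦+◃⟧ (suc n) = refl

  ⟦-◃⟧ : ∀ n → ⟦ Sign.- ◃ n ⟧ ≈ - (n · 1#)
  ⟦-◃⟧ zero    = sym -0#≈0#
  ⟦-◃⟧ (suc n) = refl

  +-homo : ∀ i j → ⟦ i ℤ.+ j ⟧ ≈ ⟦ i ⟧ + ⟦ j ⟧
  +-homo (+ m)    (+ n)    = ×-homo-+ 1# m n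
  +-homo (+ m)    -[1+ n ] = ⟦⊖⟧ m (suc n)
  +-homo -[1+ m ] (+ n)    = trans (⟦⊖⟧ n (suc m)) (+-comm _ _)
  +-homo -[1+ m ] -[1+ n ] = begin
    - (suc (suc (m ℕ.+ n)) · 1#)       ≡⟨ ≡.cong (λ k → - (suc k · 1#)) (ℕ.+-suc m n) ⟨
    - ((suc m ℕ.+ suc n) · 1#)         ≈⟨ -‿cong (×-homo-+ 1# (suc m) (suc n)) ⟩
    - (suc m · 1# + suc n · 1#)        ≈⟨ ⁻¹-∙-comm _ _ ⟨
    - (suc m · 1#) - suc n · 1#        ∎

  *-homo : ∀ i j → ⟦ i ℤ.* j ⟧ ≈ ⟦ i ⟧ * ⟦ j ⟧
  *-homo (+ m)    (+ n)    = trans (⟦+◃⟧ (m ℕ.* n)) (×1-homo-* m n)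
  *-homo (+ m)    -[1+ n ] = trans (⟦-◃⟧ (m ℕ.* suc n))
    (trans (-‿cong (×1-homo-* m (suc n))) (-‿distribʳ-* _ _))
  *-homo -[1+ m ] (+ n)    = trans (⟦-◃⟧ (suc m ℕ.* n))
    (trans (-‿cong (×1-homo-* (suc m) n)) (-‿distribˡ-* _ _))
  *-homo -[1+ m ] -[1+ n ] = begin
    (suc m ℕ.* suc n) · 1#    ≈⟨ ×1-homo-* (suc m) (suc n) ⟩
    x * y                     ≈⟨ -‿involutive _ ⟨
    - - (x * y)               ≈⟨ -‿cong (-‿distribˡ-* x y) ⟩
    - (- x * y)               ≈⟨ -‿distribʳ-* (- x) y ⟩
    - x * - y                 ∎
    where
    x y : Carrier
    x = suc m · 1#
    y = suc n · 1#

  -‿homo : ∀ i → ⟦ ℤ.- i ⟧ ≈ - ⟦ i ⟧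
  -‿homo +0       = sym -0#≈0#
  -‿homo +[1+ n ] = refl
  -‿homo -[1+ n ] = sym (-‿involutive _)

  morphism : ℤ.+-*-rawRing -Raw-AlmostCommutative⟶ fromCommutativeRing R
  morphism = record
    { ⟦_⟧ = ⟦_⟧ ; +-homo = +-homo ; *-homo = *-homo ; -‿homo = -‿homo
    ; 0-homo = refl ; 1-homo = refl }

  ⟦⟧-≟ : ∀ i j → Maybe (⟦ i ⟧ ≈ ⟦ j ⟧)
  ⟦⟧-≟ i j with i ℤ.≟ j
  ... | yes i≡j = just (reflexive (≡.cong ⟦_⟧ i≡j))
  ... | no  _   = nothing

  open RingSolver ℤ.+-*-rawRing (fromCommutativeRing R) morphism ⟦⟧-≟ public
    using (solve; con; _:+_; _:*_; _:-_; :-_; _:=_)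

-- Ordered-field arithmetic and square roots.

module OrderedField (em : ExcludedMiddle 0ℓ) (ℝ : CompleteOrderedField) where
  open CompleteOrderedField ℝ
  open IntegerRingSolver commutativeRing

  poset : Poset 0ℓ 0ℓ 0ℓ
  poset = record { isPartialOrder = IsTotalOrder.isPartialOrder isTotalOrder }

  open PartialOrderReasoning poset

  +-mono-≤ : ∀ {x y u v} → x ≤ y → u ≤ v → x + u ≤ y + v
  +-mono-≤ {x} {y} {u} {v} x≤y u≤v = begin
    x + u   ≤⟨ +-monoˡ-≤ u x≤y ⟩
    y + u   ≈⟨ +-comm y u ⟩
    u + y   ≤⟨ +-monoˡ-≤ y u≤v ⟩
    v + y   ≈⟨ +-comm v y ⟩
    y + v   ∎

  +-nonneg : ∀ {x y} → 0# ≤ x → 0# ≤ y → 0# ≤ x + y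
  +-nonneg 0≤x 0≤y = ≤-respˡ-≈ (+-identityˡ 0#) (+-mono-≤ 0≤x 0≤y)

  x≤x+y : ∀ {x y} → 0# ≤ y → x ≤ x + y
  x≤x+y {x} 0≤y = ≤-respˡ-≈ (+-identityʳ x) (+-mono-≤ ≤-refl 0≤y)

  x≤y⇒0≤y-x : ∀ {x y} → x ≤ y → 0# ≤ y - x
  x≤y⇒0≤y-x {x} x≤y = ≤-respˡ-≈ (-‿inverseʳ x) (+-monoˡ-≤ (- x) x≤y)

  0≤y-x⇒x≤y : ∀ {x y} → 0# ≤ y - x → x ≤ y
  0≤y-x⇒x≤y {x} {y} 0≤y-x = begin
    x            ≈⟨ +-identityˡ x ⟨
    0# + x       ≤⟨ +-monoˡ-≤ x 0≤y-x ⟩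
    (y - x) + x  ≈⟨ solve 2 (λ x y → (y :- x) :+ x := y) refl x y ⟩
    y            ∎

  x≤0⇒0≤-x : ∀ {x} → x ≤ 0# → 0# ≤ - x
  x≤0⇒0≤-x {x} x≤0 = ≤-respʳ-≈ (+-identityˡ (- x)) (x≤y⇒0≤y-x x≤0)

  *-monoʳ-≤ : ∀ {x y z} → 0# ≤ z → x ≤ y → z * x ≤ z * y
  *-monoʳ-≤ {x} {y} {z} 0≤z x≤y = 0≤y-x⇒x≤y (begin
    0#             ≤⟨ *-nonneg 0≤z (x≤y⇒0≤y-x x≤y) ⟩
    z * (y - x)    ≈⟨ solve 3 (λ x y z → z :* (y :- x) := z :* y :- z :* x) refl x y z ⟩
    z * y - z * x  ∎)

  *-mono-≤ : ∀ {x y u v} → 0# ≤ y → 0# ≤ u → x ≤ y → u ≤ v → x * u ≤ y * v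
  *-mono-≤ {x} {y} {u} {v} 0≤y 0≤u x≤y u≤v = begin
    x * u   ≈⟨ *-comm x u ⟩
    u * x   ≤⟨ *-monoʳ-≤ 0≤u x≤y ⟩
    u * y   ≈⟨ *-comm u y ⟩
    y * u   ≤⟨ *-monoʳ-≤ 0≤y u≤v ⟩
    y * v   ∎

  x*x-nonneg : ∀ x → 0# ≤ x * x
  x*x-nonneg x with total 0# x
  ... | inj₁ 0≤x = *-nonneg 0≤x 0≤x
  ... | inj₂ x≤0 = ≤-respʳ-≈ (solve 1 (λ x → :- x :* :- x := x :* x) refl x)
                     (*-nonneg (x≤0⇒0≤-x x≤0) (x≤0⇒0≤-x x≤0))

  0≤1 : 0# ≤ 1#
  0≤1 = ≤-respʳ-≈ (*-identityˡ 1#) (x*x-nonneg 1#)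

  1≤x⇒0≤x : ∀ {x} → 1# ≤ x → 0# ≤ x
  1≤x⇒0≤x = ≤-trans 0≤1

  1≤x⇒x≉0 : ∀ {x} → 1# ≤ x → ¬ x ≈ 0#
  1≤x⇒x≉0 1≤x x≈0 = 0≉1 (≤-antisym 0≤1 (≤-respʳ-≈ x≈0 1≤x))

  -- The inverse is `x` times the square of `x ⁻¹`, which avoids a case split on its sign.
  ⁻¹-nonneg : ∀ {x} → 0# ≤ x → ¬ x ≈ 0# → 0# ≤ x ⁻¹
  ⁻¹-nonneg {x} 0≤x x≉0 = begin
    0#                  ≤⟨ *-nonneg 0≤x (x*x-nonneg (x ⁻¹)) ⟩
    x * (x ⁻¹ * x ⁻¹)   ≈⟨ *-assoc x _ _ ⟨
    x / x * x ⁻¹        ≈⟨ *-congʳ (*-inverseʳ x x≉0) ⟩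
    1# * x ⁻¹           ≈⟨ *-identityˡ _ ⟩
    x ⁻¹                ∎

  x*z/z≈x : ∀ {x z} → ¬ z ≈ 0# → x * z / z ≈ x
  x*z/z≈x z≉0 = trans (*-assoc _ _ _) (trans (*-congˡ (*-inverseʳ _ z≉0)) (*-identityʳ _))

  x/z*z≈x : ∀ {x z} → ¬ z ≈ 0# → x / z * z ≈ x
  x/z*z≈x z≉0 = trans (*-assoc _ _ _) (trans (*-congˡ (trans (*-comm _ _) (*-inverseʳ _ z≉0))) (*-identityʳ _))

  *-cancelʳ : ∀ {x y z} → ¬ z ≈ 0# → x * z ≈ y * z → x ≈ y
  *-cancelʳ z≉0 xz≈yz = trans (sym (x*z/z≈x z≉0)) (trans (*-congʳ xz≈yz) (x*z/z≈x z≉0))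

  -- The bound `1# ≤ z` yields both the sign and the invertibility of `z`; every denominator cleared
  -- this way is at least one.
  *-cancelʳ-nonneg : ∀ {x z} → 1# ≤ z → 0# ≤ x * z → 0# ≤ x
  *-cancelʳ-nonneg {x} {z} 1≤z 0≤xz = begin
    0#              ≤⟨ *-nonneg 0≤xz (⁻¹-nonneg (1≤x⇒0≤x 1≤z) z≉0) ⟩
    x * z / z       ≈⟨ x*z/z≈x z≉0 ⟩
    x               ∎
    where
    z≉0 : ¬ z ≈ 0#
    z≉0 = 1≤x⇒x≉0 1≤z

  x*x≈0⇒x≈0 : ∀ {x} → x * x ≈ 0# → x ≈ 0#
  x*x≈0⇒x≈0 {x} x*x≈0 with em {x ≈ 0#}
  ... | yes x≈0 = x≈0
  ... | no  x≉0 = *-cancelʳ x≉0 (trans x*x≈0 (sym (zeroˡ x)))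

  -- When `y ≤ x`, the number `- ((y - x) * (y - x))` equals `(y * y - x * x) + (y + y) * (x - y)`,
  -- a sum of nonnegative terms, so the square and with it `y - x` vanishes.
  x*x≤y*y⇒x≤y : ∀ {x y} → 0# ≤ y → x * x ≤ y * y → x ≤ y
  x*x≤y*y⇒x≤y {x} {y} 0≤y x²≤y² with total x y
  ... | inj₁ x≤y = x≤y
  ... | inj₂ y≤x = 0≤y-x⇒x≤y (≤-reflexive (sym (x*x≈0⇒x≈0 (≤-antisym [y-x]²≤0 (x*x-nonneg _)))))
    where
    [y-x]²≤0 : (y - x) * (y - x) ≤ 0#
    [y-x]²≤0 = 0≤y-x⇒x≤y (begin
      0#                                             ≤⟨ +-nonneg (x≤y⇒0≤y-x x²≤y²)
                                                          (*-nonneg (+-nonneg 0≤y 0≤y) (x≤y⇒0≤y-x y≤x)) ⟩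
      (y * y - x * x) + (y + y) * (x - y)
        ≈⟨ solve 2 (λ x y → (y :* y :- x :* x) :+ (y :+ y) :* (x :- y) :=
                             con +0 :- (y :- x) :* (y :- x)) refl x y ⟩
      0# - (y - x) * (y - x)                         ∎)

  ^2≈ : ∀ x → x ^ 2 ≈ x * x
  ^2≈ x = *-congˡ (*-identityʳ x)

  ^-nonneg : ∀ {x} n → 0# ≤ x → 0# ≤ x ^ n
  ^-nonneg zero    0≤x = 0≤1
  ^-nonneg (suc n) 0≤x = *-nonneg 0≤x (^-nonneg n 0≤x)

  fromℕ-nonneg : ∀ n → 0# ≤ fromℕ n
  fromℕ-nonneg zero    = ≤-refl
  fromℕ-nonneg (suc n) = +-nonneg 0≤1 (fromℕ-nonneg n)

  1≤fromℕ-suc : ∀ n → 1# ≤ fromℕ (suc n)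
  1≤fromℕ-suc n = x≤x+y (fromℕ-nonneg n)

  ^-square : ∀ {x y} n → y * y ≈ x → y ^ n * y ^ n ≈ x ^ n
  ^-square         zero    y²≈x = *-identityˡ 1#
  ^-square {x} {y} (suc n) y²≈x = begin-equality
    y * y ^ n * (y * y ^ n)
      ≈⟨ solve 2 (λ y z → y :* z :* (y :* z) := y :* y :* (z :* z)) refl y (y ^ n) ⟩
    y * y * (y ^ n * y ^ n)  ≈⟨ *-cong y²≈x (^-square n y²≈x) ⟩
    x * x ^ n                ∎

  √-nonneg : ∀ x → 0# ≤ √ x
  √-nonneg x = proj₁ (proj₂ (complete (SqrtSet x) (0# , inj₁ ≤-refl) (sqrtSet-bounded x))) 0# (inj₁ ≤-refl)

  √-upper : ∀ {x z} → z * z ≤ x → z ≤ √ x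
  √-upper {x} {z} z²≤x =
    proj₁ (proj₂ (complete (SqrtSet x) (0# , inj₁ ≤-refl) (sqrtSet-bounded x))) z (inj₂ z²≤x)

  √-least : ∀ {x z} → 0# ≤ z → x ≤ z * z → √ x ≤ z
  √-least {x} {z} 0≤z x≤z² =
    proj₂ (proj₂ (complete (SqrtSet x) (0# , inj₁ ≤-refl) (sqrtSet-bounded x))) z bound
    where
    bound : IsUpperBound (SqrtSet x) z
    bound w (inj₁ w≤0)  = ≤-trans w≤0 0≤z
    bound w (inj₂ w²≤x) = x*x≤y*y⇒x≤y 0≤z (≤-trans w²≤x x≤z²)

  -- With y = √ x and δ = (y² - x) / (2y + 1), the point y - δ is still an
  -- upper bound of SqrtSet x, so δ ≤ 0.
  √*√≤ : ∀ {x} → 0# ≤ x → √ x * √ x ≤ x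
  √*√≤ {x} 0≤x with total (√ x * √ x) x
  ... | inj₁ y²≤x = y²≤x
  ... | inj₂ x≤y² = 0≤y-x⇒x≤y (begin
      0#             ≤⟨ *-nonneg (x≤0⇒0≤-x δ≤0) (1≤x⇒0≤x 1≤b) ⟩
      - δ * b        ≈⟨ solve 2 (λ δ b → :- δ :* b := :- (δ :* b)) refl δ b ⟩
      - (δ * b)      ≈⟨ -‿cong δb≈ ⟩
      - (y * y - x)  ≈⟨ solve 2 (λ x y → :- (y :* y :- x) := x :- y :* y) refl x y ⟩
      x - y * y      ∎)
    where
    y b δ : Carrier
    y = √ x
    b = 1# + (y + y)
    δ = (y * y - x) * b ⁻¹

    1≤b : 1# ≤ b
    1≤b = x≤x+y (+-nonneg (√-nonneg x) (√-nonneg x))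

    δb≈ : δ * b ≈ y * y - x
    δb≈ = x/z*z≈x (1≤x⇒x≉0 1≤b)

    0≤δ : 0# ≤ δ
    0≤δ = *-cancelʳ-nonneg 1≤b (≤-respʳ-≈ (sym δb≈) (x≤y⇒0≤y-x x≤y²))

    -- `√-least` asks for a nonnegative bound, because `SqrtSet x` contains every nonpositive
    -- number.
    0≤y-δ : 0# ≤ y - δ
    0≤y-δ = *-cancelʳ-nonneg 1≤b (begin
      0#                         ≤⟨ +-nonneg (+-nonneg (x*x-nonneg y) (√-nonneg x)) 0≤x ⟩
      y * y + y + x
        ≈⟨ solve 2 (λ x y → y :* y :+ y :+ x :=
                             y :* (con (+ 1) :+ (y :+ y)) :- (y :* y :- x)) refl x y ⟩
      y * b - (y * y - x)        ≈⟨ +-congˡ (-‿cong δb≈) ⟨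
      y * b - δ * b              ≈⟨ solve 3 (λ y b δ → y :* b :- δ :* b := (y :- δ) :* b) refl y b δ ⟩
      (y - δ) * b                ∎)

    x≤[y-δ]² : x ≤ (y - δ) * (y - δ)
    x≤[y-δ]² = 0≤y-x⇒x≤y (begin
      0#                                       ≤⟨ +-nonneg 0≤δ (x*x-nonneg δ) ⟩
      δ + δ * δ
        ≈⟨ solve 2 (λ δ y → δ :+ δ :* δ :=
             (δ :* (con (+ 1) :+ (y :+ y)) :- (y :* δ :+ y :* δ)) :+ δ :* δ) refl δ y ⟩
      (δ * b - (y * δ + y * δ)) + δ * δ        ≈⟨ +-congʳ (+-congʳ δb≈) ⟩
      ((y * y - x) - (y * δ + y * δ)) + δ * δ
        ≈⟨ solve 3 (λ x y δ → ((y :* y :- x) :- (y :* δ :+ y :* δ)) :+ δ :* δ :=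
             (y :- δ) :* (y :- δ) :- x) refl x y δ ⟩
      (y - δ) * (y - δ) - x                    ∎)

    δ≤0 : δ ≤ 0#
    δ≤0 = 0≤y-x⇒x≤y (≤-respʳ-≈ (solve 2 (λ y δ → (y :- δ) :- y := con +0 :- δ) refl y δ)
      (x≤y⇒0≤y-x (√-least 0≤y-δ x≤[y-δ]²)))

  -- Dually, with δ = (x - y²) / (2y + 1 + x) ≤ 1 the point y + δ lies in
  -- SqrtSet x.
  ≤√*√ : ∀ {x} → 0# ≤ x → x ≤ √ x * √ x
  ≤√*√ {x} 0≤x with total (√ x * √ x) x
  ... | inj₂ x≤y² = x≤y²
  ... | inj₁ y²≤x = 0≤y-x⇒x≤y (begin
      0#             ≤⟨ *-nonneg (x≤0⇒0≤-x δ≤0) (1≤x⇒0≤x 1≤b) ⟩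
      - δ * b        ≈⟨ solve 2 (λ δ b → :- δ :* b := :- (δ :* b)) refl δ b ⟩
      - (δ * b)      ≈⟨ -‿cong δb≈ ⟩
      - (x - y * y)  ≈⟨ solve 2 (λ x y → :- (x :- y :* y) := y :* y :- x) refl x y ⟩
      y * y - x      ∎)
    where
    y b δ : Carrier
    y = √ x
    b = 1# + (y + y + x)
    δ = (x - y * y) * b ⁻¹

    1≤b : 1# ≤ b
    1≤b = x≤x+y (+-nonneg (+-nonneg (√-nonneg x) (√-nonneg x)) 0≤x)

    δb≈ : δ * b ≈ x - y * y
    δb≈ = x/z*z≈x (1≤x⇒x≉0 1≤b)

    0≤δ : 0# ≤ δ
    0≤δ = *-cancelʳ-nonneg 1≤b (≤-respʳ-≈ (sym δb≈) (x≤y⇒0≤y-x y²≤x))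

    -- The summand `x` of `b` is there for this: it makes `b` exceed `x - y * y`, so that `δ * δ` is
    -- absorbed by `δ` below.
    0≤1-δ : 0# ≤ 1# - δ
    0≤1-δ = *-cancelʳ-nonneg 1≤b (begin
      0#                         ≤⟨ +-nonneg (+-nonneg 0≤1 (+-nonneg (√-nonneg x) (√-nonneg x))) (x*x-nonneg y) ⟩
      1# + (y + y) + y * y
        ≈⟨ solve 2 (λ x y → con (+ 1) :+ (y :+ y) :+ y :* y :=
                             (con (+ 1) :+ (y :+ y :+ x)) :- (x :- y :* y)) refl x y ⟩
      b - (x - y * y)            ≈⟨ +-congˡ (-‿cong δb≈) ⟨
      b - δ * b                  ≈⟨ solve 2 (λ b δ → b :- δ :* b := (con (+ 1) :- δ) :* b) refl b δ ⟩
      (1# - δ) * b               ∎)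

    [y+δ]²≤x : (y + δ) * (y + δ) ≤ x
    [y+δ]²≤x = 0≤y-x⇒x≤y (begin
      0#                                       ≤⟨ *-nonneg 0≤δ (+-nonneg 0≤1-δ 0≤x) ⟩
      δ * ((1# - δ) + x)
        ≈⟨ solve 3 (λ x y δ → δ :* ((con (+ 1) :- δ) :+ x) :=
             (δ :* (con (+ 1) :+ (y :+ y :+ x)) :- (y :* δ :+ y :* δ)) :- δ :* δ) refl x y δ ⟩
      (δ * b - (y * δ + y * δ)) - δ * δ        ≈⟨ +-congʳ (+-congʳ δb≈) ⟩
      ((x - y * y) - (y * δ + y * δ)) - δ * δ
        ≈⟨ solve 3 (λ x y δ → ((x :- y :* y) :- (y :* δ :+ y :* δ)) :- δ :* δ :=
             x :- (y :+ δ) :* (y :+ δ)) refl x y δ ⟩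
      x - (y + δ) * (y + δ)                    ∎)

    δ≤0 : δ ≤ 0#
    δ≤0 = 0≤y-x⇒x≤y (≤-respʳ-≈ (solve 2 (λ y δ → y :- (y :+ δ) := con +0 :- δ) refl y δ)
      (x≤y⇒0≤y-x (√-upper [y+δ]²≤x)))

  √*√≈ : ∀ {x} → 0# ≤ x → √ x * √ x ≈ x
  √*√≈ 0≤x = ≤-antisym (√*√≤ 0≤x) (≤√*√ 0≤x)

-- Finite sums, indicators and sums over lists.

module Sums (ℝ : CompleteOrderedField) where
  open CompleteOrderedField ℝ
  open SemiringSum semiring using (sum-cong-≋; ∑-distrib-+; ∑-comm; *-distribˡ-sum)

  sum-cong : ∀ n {f g : Fin n → Carrier} → (∀ i → f i ≈ g i) → sum f ≈ sum g
  sum-cong n = sum-cong-≋ {n}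

  sum-+ : ∀ n (f g : Fin n → Carrier) → sum (λ i → f i + g i) ≈ sum f + sum g
  sum-+ n = ∑-distrib-+ {n}

  sum-* : ∀ n x (f : Fin n → Carrier) → x * sum f ≈ sum (λ i → x * f i)
  sum-* n = *-distribˡ-sum {n}

  sum-swap : ∀ m n (f : Fin m → Fin n → Carrier) →
             sum (λ i → sum (f i)) ≈ sum (λ j → sum (λ i → f i j))
  sum-swap m n = ∑-comm {m} {n}

  sum-const : ∀ n c → sum {n} (λ _ → c) ≈ fromℕ n * c
  sum-const zero    c = sym (zeroˡ c)
  sum-const (suc n) c =
    trans (+-cong (sym (*-identityˡ c)) (sum-const n c)) (sym (distribʳ c 1# (fromℕ n)))

  sum-zero : ∀ {n} (f : Fin n → Carrier) → (∀ i → f i ≈ 0#) → sum f ≈ 0#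
  sum-zero {zero}  f f≈0 = refl
  sum-zero {suc n} f f≈0 = trans (+-cong (f≈0 0F) (sum-zero (f ∘ Fin.suc) (f≈0 ∘ Fin.suc))) (+-identityˡ 0#)

  sum-++ : ∀ m {n} (f : Fin (m ℕ.+ n) → Carrier) →
           sum f ≈ sum (λ i → f (i ↑ˡ n)) + sum (λ j → f (m ↑ʳ j))
  sum-++ zero    f = sym (+-identityˡ _)
  sum-++ (suc m) f = trans (+-congˡ (sum-++ m (f ∘ Fin.suc))) (sym (+-assoc _ _ _))

  sum-combine : ∀ m n (f : Fin (m ℕ.* n) → Carrier) →
                sum f ≈ sum {m} (λ i → sum {n} (λ j → f (combine i j)))
  sum-combine zero    n f = refl
  sum-combine (suc m) n f =
    trans (sum-++ n f) (+-congˡ (sum-combine m n (λ k → f (n ↑ʳ k))))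

module Indicator (em : ExcludedMiddle 0ℓ) (ℝ : CompleteOrderedField) where
  open CompleteOrderedField ℝ

  -- Deciding by excluded middle admits arbitrary propositions, in particular equality of
  -- concatenated hash values, for which `S` provides no decision procedure.
  𝟙 : Set → Carrier
  𝟙 P with em {P}
  ... | yes _ = 1#
  ... | no  _ = 0#

  𝟙-yes : ∀ {P} → P → 𝟙 P ≈ 1#
  𝟙-yes {P} p with em {P}
  ... | yes _ = refl
  ... | no ¬p = contradiction p ¬p

  𝟙-no : ∀ {P} → ¬ P → 𝟙 P ≈ 0#
  𝟙-no {P} ¬p with em {P}
  ... | yes p = contradiction p ¬p
  ... | no  _ = refl

  𝟙-× : ∀ {P Q} → 𝟙 (P × Q) ≈ 𝟙 P * 𝟙 Q
  𝟙-× {P} {Q} with em {P} | em {Q}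
  ... | yes p | yes q = trans (𝟙-yes (p , q)) (sym (*-identityˡ 1#))
  ... | yes _ | no ¬q = trans (𝟙-no (¬q ∘ proj₂)) (sym (zeroʳ 1#))
  ... | no ¬p | _     = trans (𝟙-no (¬p ∘ proj₁)) (sym (zeroˡ _))

module ListSums (em : ExcludedMiddle 0ℓ) (ℝ : CompleteOrderedField) {A : Set} where
  open CompleteOrderedField ℝ
  open OrderedField em ℝ using (+-mono-≤)
  open Indicator em ℝ
  open IntegerRingSolver commutativeRing

  ∑ : List A → (A → Carrier) → Carrier
  ∑ xs f = List.foldr _+_ 0# (List.map f xs)

  ∑-cong : ∀ xs {f g} → (∀ x → f x ≈ g x) → ∑ xs f ≈ ∑ xs g
  ∑-cong []       f≈g = refl
  ∑-cong (x ∷ xs) f≈g = +-cong (f≈g x) (∑-cong xs f≈g)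

  ∑-mono : ∀ xs {f g} → (∀ x → f x ≤ g x) → ∑ xs f ≤ ∑ xs g
  ∑-mono []       f≤g = ≤-refl
  ∑-mono (x ∷ xs) f≤g = +-mono-≤ (f≤g x) (∑-mono xs f≤g)

  ∑-+ : ∀ xs f g → ∑ xs (λ x → f x + g x) ≈ ∑ xs f + ∑ xs g
  ∑-+ []       f g = sym (+-identityˡ 0#)
  ∑-+ (x ∷ xs) f g = trans (+-congˡ (∑-+ xs f g))
    (solve 4 (λ a b c d → (a :+ b) :+ (c :+ d) := (a :+ c) :+ (b :+ d)) refl _ _ _ _)

  ∑-*ˡ : ∀ xs c f → ∑ xs (λ x → c * f x) ≈ c * ∑ xs f
  ∑-*ˡ []       c f = sym (zeroʳ c)
  ∑-*ˡ (x ∷ xs) c f = trans (+-congˡ (∑-*ˡ xs c f)) (sym (distribˡ c _ _))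

  ∑-const : ∀ xs c → ∑ xs (λ _ → c) ≈ fromℕ (length xs) * c
  ∑-const []       c = sym (zeroˡ c)
  ∑-const (x ∷ xs) c = trans (+-cong (sym (*-identityˡ c)) (∑-const xs c))
    (sym (distribʳ c 1# _))

  ∑-*-∑ : ∀ xs f ys g → ∑ xs f * ∑ ys g ≈ ∑ xs (λ x → ∑ ys (λ y → f x * g y))
  ∑-*-∑ xs f ys g = trans (*-comm _ _) (trans (sym (∑-*ˡ xs _ f))
    (∑-cong xs (λ x → trans (*-comm _ _) (sym (∑-*ˡ ys (f x) g)))))

  -- Turns a counter of `A` into a sum of indicators, on which linearity of expectation can act.
  fromℕ-length-filter : ∀ {P : A → Set} (P? : ∀ x → Dec (P x)) xs →
                        fromℕ (length (filter P? xs)) ≈ ∑ xs (λ x → 𝟙 (P x))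
  fromℕ-length-filter P? []       = refl
  fromℕ-length-filter P? (x ∷ xs) with P? x
  ... | yes p = +-cong (sym (𝟙-yes p)) (fromℕ-length-filter P? xs)
  ... | no ¬p = trans (fromℕ-length-filter P? xs)
    (trans (sym (+-identityˡ _)) (+-congʳ (sym (𝟙-no ¬p))))

-- Finite additivity and expectations of simple random variables.

module Probability (em : ExcludedMiddle 0ℓ) (ℝ : CompleteOrderedField)
                   (𝒫 : Real.ProbabilitySpace ℝ) where
  open CompleteOrderedField ℝ
  open OrderedField em ℝ
  open Sums ℝ
  open Indicator em ℝ
  open Real ℝ
  open ProbabilitySpace 𝒫
  open PartialOrderReasoning poset

  measurable-∅ : Measurable ∅
  measurable-∅ = measurable-resp ((λ ¬u → ¬u _) , λ ()) (measurable-∁ measurable-U)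

  private
    -- Padding with `∅` specialises the countable axioms to two events.
    pair : Pred Ω 0ℓ → Pred Ω 0ℓ → ℕ → Pred Ω 0ℓ
    pair A B zero          = A
    pair A B (suc zero)    = B
    pair A B (suc (suc _)) = ∅

    pair-measurable : ∀ {A B} → Measurable A → Measurable B → ∀ n → Measurable (pair A B n)
    pair-measurable mA mB zero          = mA
    pair-measurable mA mB (suc zero)    = mB
    pair-measurable mA mB (suc (suc _)) = measurable-∅

    ⋃-pair : ∀ {A B} → ⋃ ℕ (pair A B) ≐ (A ∪ B)
    ⋃-pair = (λ { (0 , a) → inj₁ a ; (1 , b) → inj₂ b ; (suc (suc _) , ()) })
           , (λ { (inj₁ a) → 0 , a ; (inj₂ b) → 1 , b })

  measurable-∪ : ∀ {A B} → Measurable A → Measurable B → Measurable (A ∪ B)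
  measurable-∪ mA mB = measurable-resp ⋃-pair (measurable-⋃ _ (pair-measurable mA mB))

  measurable-∩ : ∀ {A B} → Measurable A → Measurable B → Measurable (A ∩ B)
  measurable-∩ {A} {B} mA mB =
    measurable-resp (to , λ { (a , b) (inj₁ ¬a) → ¬a a ; (a , b) (inj₂ ¬b) → ¬b b })
      (measurable-∁ (measurable-∪ (measurable-∁ mA) (measurable-∁ mB)))
    where
    to : ∁ (∁ A ∪ ∁ B) ⊆ (A ∩ B)
    to {ω} ¬¬ with em {A ω} | em {B ω}
    ... | yes a | yes b = a , b
    ... | no ¬a | _     = contradiction (inj₁ ¬a) ¬¬
    ... | yes _ | no ¬b = contradiction (inj₂ ¬b) ¬¬

  measurable-∀ : ∀ {n} (A : Fin n → Pred Ω 0ℓ) → (∀ i → Measurable (A i)) →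
                 Measurable (λ ω → ∀ i → A i ω)
  measurable-∀ {zero}  A mA = measurable-resp ((λ _ ()) , _) measurable-U
  measurable-∀ {suc n} A mA =
    measurable-resp ((λ { (a , as) 0F → a ; (a , as) (Fin.suc i) → as i })
                    , λ as → as 0F , (as ∘ Fin.suc))
      (measurable-∩ (mA 0F) (measurable-∀ (A ∘ Fin.suc) (mA ∘ Fin.suc)))

  measurable-∃ : ∀ {n} (A : Fin n → Pred Ω 0ℓ) → (∀ i → Measurable (A i)) →
                 Measurable (λ ω → ∃[ i ] A i ω)
  measurable-∃ {zero}  A mA = measurable-resp ((λ ()) , λ ()) measurable-∅
  measurable-∃ {suc n} A mA =
    measurable-resp ((λ { (inj₁ a) → 0F , a ; (inj₂ (i , a)) → Fin.suc i , a })
                    , λ { (0F , a) → inj₁ a ; (Fin.suc i , a) → inj₂ (i , a) })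
      (measurable-∪ (mA 0F) (measurable-∃ (A ∘ Fin.suc) (mA ∘ Fin.suc)))

  -- The constant sequence `∅` is vacuously disjoint with union `∅`, so already its two-term partial
  -- sum is at most `ℙ ∅`. This forces `ℙ ∅ ≤ 0#`.
  ℙ-∅ : ℙ ∅ ≈ 0#
  ℙ-∅ = ≤-antisym (0≤y-x⇒x≤y (begin
      0#               ≤⟨ x≤y⇒0≤y-x 2ℙ∅≤ℙ∅ ⟩
      ℙ ∅ - (ℙ ∅ + (ℙ ∅ + 0#))
        ≈⟨ solve 1 (λ x → x :- (x :+ (x :+ con +0)) := con +0 :- x) refl (ℙ ∅) ⟩
      0# - ℙ ∅         ∎)) (ℙ-nonneg measurable-∅)
    where
    open IntegerRingSolver commutativeRing
    m∅ : (n : ℕ) → Measurable ∅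
    m∅ _ = measurable-∅
    2ℙ∅≤ℙ∅ : ℙ ∅ + (ℙ ∅ + 0#) ≤ ℙ ∅
    2ℙ∅≤ℙ∅ = ≤-respʳ-≈ (ℙ-cong (measurable-⋃ _ m∅) ((λ ()) , λ ()))
      (proj₁ (ℙ-⋃ (λ _ → ∅) m∅ (λ _ _ _ ())) _ (2 , refl))

  -- From two terms on, every partial sum of the padded sequence equals `ℙ A + ℙ B`, and the shorter
  -- ones are smaller. This value is thus both an upper bound and attained, hence the least upper
  -- bound.
  ℙ-∪ : ∀ {A B} → Measurable A → Measurable B → (∀ {ω} → A ω → ¬ B ω) →
        ℙ (A ∪ B) ≈ ℙ A + ℙ B
  ℙ-∪ {A} {B} mA mB A∩B=∅ = begin-equality
    ℙ (A ∪ B)           ≈⟨ ℙ-cong (measurable-⋃ _ mAB) ⋃-pair ⟨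
    ℙ (⋃ ℕ (pair A B))  ≈⟨ ≤-antisym (proj₂ lub _ upper) (proj₁ lub _ (2 , sym (partial 0))) ⟩
    ℙ A + ℙ B           ∎
    where
    mAB : ∀ n → Measurable (pair A B n)
    mAB = pair-measurable mA mB

    disjoint : ∀ m n ω → pair A B m ω → pair A B n ω → m ≡ n
    disjoint 0 0 ω a b = ≡.refl
    disjoint 0 1 ω a b = contradiction b (A∩B=∅ a)
    disjoint 1 0 ω b a = contradiction b (A∩B=∅ a)
    disjoint 1 1 ω a b = ≡.refl
    disjoint 0 (suc (suc _)) ω a ()
    disjoint 1 (suc (suc _)) ω a ()
    disjoint (suc (suc _)) _ ω ()

    lub = ℙ-⋃ (pair A B) mAB disjoint

    partial : ∀ n → sum {suc (suc n)} (λ i → ℙ (pair A B (toℕ i))) ≈ ℙ A + ℙ B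
    partial n = +-congˡ (trans (+-congˡ (sum-zero {n} (λ _ → ℙ ∅) (λ _ → ℙ-∅))) (+-identityʳ _))

    0≤ℙA : 0# ≤ ℙ A
    0≤ℙA = ℙ-nonneg mA
    0≤ℙB : 0# ≤ ℙ B
    0≤ℙB = ℙ-nonneg mB

    upper : IsUpperBound (λ s → ∃[ n ] s ≈ sum {n} (λ i → ℙ (pair A B (toℕ i)))) (ℙ A + ℙ B)
    upper s (0 , s≈)           = ≤-trans (≤-reflexive s≈) (+-nonneg 0≤ℙA 0≤ℙB)
    upper s (1 , s≈)           = ≤-trans (≤-reflexive (trans s≈ (+-identityʳ _))) (x≤x+y 0≤ℙB)
    upper s (suc (suc n) , s≈) = ≤-reflexive (trans s≈ (partial n))

  ℙ-mono : ∀ {A B} → Measurable A → Measurable B → A ⊆ B → ℙ A ≤ ℙ B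
  ℙ-mono {A} {B} mA mB A⊆B = begin
    ℙ A                  ≤⟨ x≤x+y (ℙ-nonneg m) ⟩
    ℙ A + ℙ (B ∩ ∁ A)    ≈⟨ ℙ-∪ mA m (λ a (_ , ¬a) → ¬a a) ⟨
    ℙ (A ∪ (B ∩ ∁ A))    ≈⟨ ℙ-cong (measurable-∪ mA m) ((λ { (inj₁ a) → A⊆B a ; (inj₂ (b , _)) → b }) , from) ⟩
    ℙ B                  ∎
    where
    m : Measurable (B ∩ ∁ A)
    m = measurable-∩ mB (measurable-∁ mA)
    from : B ⊆ (A ∪ (B ∩ ∁ A))
    from {ω} b with em {A ω}
    ... | yes a = inj₁ a
    ... | no ¬a = inj₂ (b , ¬a)

  ℙ≤1 : ∀ {A} → Measurable A → ℙ A ≤ 1#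
  ℙ≤1 mA = ≤-respʳ-≈ ℙ-U (ℙ-mono mA measurable-U _)

  ℙ-∃ : ∀ {n} (A : Fin n → Pred Ω 0ℓ) → (∀ i → Measurable (A i)) →
        (∀ {i j ω} → A i ω → A j ω → i ≡ j) →
        ℙ (λ ω → ∃[ i ] A i ω) ≈ sum (λ i → ℙ (A i))
  ℙ-∃ {zero}  A mA dis = trans (ℙ-cong (measurable-∃ A mA) ((λ ()) , λ ())) ℙ-∅
  ℙ-∃ {suc n} A mA dis = begin-equality
    ℙ (λ ω → ∃[ i ] A i ω)
      ≈⟨ ℙ-cong (measurable-∃ A mA)
           ( (λ { (0F , a) → inj₁ a ; (Fin.suc i , a) → inj₂ (i , a) })
           , (λ { (inj₁ a) → 0F , a ; (inj₂ (i , a)) → Fin.suc i , a })) ⟩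
    ℙ (A 0F ∪ (λ ω → ∃[ i ] A (Fin.suc i) ω))
      ≈⟨ ℙ-∪ (mA 0F) (measurable-∃ _ (mA ∘ Fin.suc)) (λ a (i , b) → contradiction (dis a b) λ ()) ⟩
    ℙ (A 0F) + ℙ (λ ω → ∃[ i ] A (Fin.suc i) ω)
      ≈⟨ +-congˡ (ℙ-∃ (A ∘ Fin.suc) (mA ∘ Fin.suc) (λ a b → Fin.suc-injective (dis a b))) ⟩
    ℙ (A 0F) + sum (λ i → ℙ (A (Fin.suc i))) ∎

  ℙ-total : ∀ {n} {B : Pred Ω 0ℓ} (cell : Ω → Fin n) → (∀ i → Measurable (λ ω → cell ω ≡ i)) →
            Measurable B → ℙ B ≈ sum (λ i → ℙ (B ∩ (λ ω → cell ω ≡ i)))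
  ℙ-total cell mcell mB = trans
    (ℙ-cong mB ((λ b → _ , b , ≡.refl) , λ (_ , b , _) → b))
    (ℙ-∃ _ (λ i → measurable-∩ mB (mcell i)) (λ (_ , p) (_ , q) → ≡.trans (≡.sym p) q))

  ℙ-certain : ∀ {A} → (∀ ω → A ω) → ℙ A ≈ 1#
  ℙ-certain all = trans (sym (ℙ-cong measurable-U ((λ {ω} _ → all ω) , _))) ℙ-U

  𝔼-cong : ∀ {X X′ e e′} → (∀ ω → X ω ≈ X′ ω) → e ≈ e′ → Expectation 𝒫 X e → Expectation 𝒫 X′ e′
  𝔼-cong X≈X′ e≈e′ E = record
    { Expectation E
    ; X≈value = λ ω → trans (sym (X≈X′ ω)) (Expectation.X≈value E ω)
    ; e≈sum   = trans (sym e≈e′) (Expectation.e≈sum E) }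

  𝔼-const : ∀ c → Expectation 𝒫 (λ _ → c) c
  𝔼-const c = record
    { size            = 1
    ; cell            = λ _ → 0F
    ; cell-measurable = λ { 0F → measurable-resp U≐ measurable-U }
    ; value           = λ _ → c
    ; X≈value         = λ _ → refl
    ; e≈sum           = sym (begin-equality
        c * ℙ (λ _ → 0F ≡ 0F) + 0#  ≈⟨ +-identityʳ _ ⟩
        c * ℙ (λ _ → 0F ≡ 0F)       ≈⟨ *-congˡ (ℙ-cong measurable-U U≐) ⟨
        c * ℙ U                     ≈⟨ *-congˡ ℙ-U ⟩
        c * 1#                      ≈⟨ *-identityʳ c ⟩
        c                           ∎) }
    where
    U≐ : U ≐ (λ (_ : Ω) → _≡_ {A = Fin 1} 0F 0F)
    U≐ = (λ _ → ≡.refl) , _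

  𝔼-* : ∀ c {X e} → Expectation 𝒫 X e → Expectation 𝒫 (λ ω → c * X ω) (c * e)
  𝔼-* c {X} {e} E = record
    { Expectation E
    ; value   = λ i → c * E.value i
    ; X≈value = λ ω → *-congˡ (E.X≈value ω)
    ; e≈sum   = begin-equality
        c * e                                                 ≈⟨ *-congˡ E.e≈sum ⟩
        c * sum (λ i → E.value i * ℙ (λ ω → E.cell ω ≡ i))    ≈⟨ sum-* E.size c _ ⟩
        sum (λ i → c * (E.value i * ℙ (λ ω → E.cell ω ≡ i)))  ≈⟨ sum-cong E.size (λ i → *-assoc c _ _) ⟨
        sum (λ i → c * E.value i * ℙ (λ ω → E.cell ω ≡ i))    ∎ }
    where module E = Expectation E

  -- Both variables are constant on the common refinement of their partitions, whose cells
  -- `CE i ∩ CF j` are numbered by `combine i j`. Summing the cell probabilities along a row or a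
  -- column recovers the probabilities of the original cells.
  𝔼-+ : ∀ {X Y e f} → Expectation 𝒫 X e → Expectation 𝒫 Y f →
        Expectation 𝒫 (λ ω → X ω + Y ω) (e + f)
  𝔼-+ {X} {Y} {e} {f} E F = record
    { size            = E.size ℕ.* F.size
    ; cell            = cell
    ; cell-measurable = λ k → measurable-resp (cell≐ k) (mEF _ _)
    ; value           = value
    ; X≈value         = λ ω → trans (+-cong (E.X≈value ω) (F.X≈value ω))
                                    (reflexive (≡.sym (value-combine (E.cell ω) (F.cell ω))))
    ; e≈sum           = begin-equality
        e + f
          ≈⟨ +-cong E.e≈sum F.e≈sum ⟩
        sum (λ i → E.value i * ℙ (CE i)) + sum (λ j → F.value j * ℙ (CF j))
          ≈⟨ +-cong (sum-cong E.size (λ i → trans (*-congˡ (ℙ-row i)) (sum-* F.size _ _)))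
                    (sum-cong F.size (λ j → trans (*-congˡ (ℙ-column j)) (sum-* E.size _ _))) ⟩
        sum (λ i → sum (λ j → E.value i * ℙ (CE i ∩ CF j))) + sum (λ j → sum (λ i → F.value j * ℙ (CE i ∩ CF j)))
          ≈⟨ +-congˡ (sum-swap F.size E.size (λ j i → F.value j * ℙ (CE i ∩ CF j))) ⟩
        sum (λ i → sum (λ j → E.value i * ℙ (CE i ∩ CF j))) + sum (λ i → sum (λ j → F.value j * ℙ (CE i ∩ CF j)))
          ≈⟨ sum-+ E.size _ _ ⟨
        sum (λ i → sum (λ j → E.value i * ℙ (CE i ∩ CF j)) + sum (λ j → F.value j * ℙ (CE i ∩ CF j)))
          ≈⟨ sum-cong E.size (λ i → sum-+ F.size _ _) ⟨
        sum (λ i → sum (λ j → E.value i * ℙ (CE i ∩ CF j) + F.value j * ℙ (CE i ∩ CF j)))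
          ≈⟨ sum-cong E.size (λ i → sum-cong F.size (λ j → trans
               (*-cong (reflexive (value-combine i j)) (sym (ℙ-cong (mEF i j) (combine≐ i j)))) (distribʳ _ _ _))) ⟨
        sum (λ i → sum (λ j → value (combine {E.size} {F.size} i j) * ℙ (λ ω → cell ω ≡ combine i j)))
          ≈⟨ sum-combine E.size F.size _ ⟨
        sum (λ k → value k * ℙ (λ ω → cell ω ≡ k)) ∎ }
    where
    module E = Expectation E
    module F = Expectation F

    CE : Fin E.size → Pred Ω 0ℓ
    CE i ω = E.cell ω ≡ i
    CF : Fin F.size → Pred Ω 0ℓ
    CF j ω = F.cell ω ≡ j

    cell : Ω → Fin (E.size ℕ.* F.size)
    cell ω = combine (E.cell ω) (F.cell ω)

    rowOf : Fin (E.size ℕ.* F.size) → Fin E.size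
    rowOf k = proj₁ (remQuot {E.size} F.size k)
    colOf : Fin (E.size ℕ.* F.size) → Fin F.size
    colOf k = proj₂ (remQuot {E.size} F.size k)

    value : Fin (E.size ℕ.* F.size) → Carrier
    value k = E.value (rowOf k) + F.value (colOf k)

    value-combine : ∀ i j → value (combine i j) ≡ E.value i + F.value j
    value-combine i j = ≡.cong (λ (i , j) → E.value i + F.value j) (Fin.remQuot-combine i j)

    mEF : ∀ i j → Measurable (CE i ∩ CF j)
    mEF i j = measurable-∩ (E.cell-measurable i) (F.cell-measurable j)

    ℙ-row : ∀ i → ℙ (CE i) ≈ sum (λ j → ℙ (CE i ∩ CF j))
    ℙ-row i = ℙ-total F.cell F.cell-measurable (E.cell-measurable i)

    ℙ-column : ∀ j → ℙ (CF j) ≈ sum (λ i → ℙ (CE i ∩ CF j))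
    ℙ-column j = trans (ℙ-total E.cell E.cell-measurable (F.cell-measurable j))
      (sum-cong E.size (λ i → sym (ℙ-cong (mEF i j) ((λ (a , b) → b , a) , λ (b , a) → a , b))))

    combine≐ : ∀ i j → (CE i ∩ CF j) ≐ (λ ω → cell ω ≡ combine i j)
    combine≐ i j = (λ (p , q) → ≡.cong₂ combine p q) , Fin.combine-injective _ _ i j

    cell≐ : ∀ k → (CE (rowOf k) ∩ CF (colOf k)) ≐ (λ ω → cell ω ≡ k)
    cell≐ k = ≡.subst (λ l → (CE (rowOf k) ∩ CF (colOf k)) ≐ (λ ω → cell ω ≡ l))
                (Fin.combine-remQuot {E.size} F.size k) (combine≐ (rowOf k) (colOf k))

  𝔼-𝟙 : ∀ {A} → Measurable A → Expectation 𝒫 (λ ω → 𝟙 (A ω)) (ℙ A)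
  𝔼-𝟙 {A} mA = record
    { size            = 2
    ; cell            = cell
    ; cell-measurable = λ { 0F → measurable-resp A≐ mA ; 1F → measurable-resp ∁A≐ (measurable-∁ mA) }
    ; value           = value
    ; X≈value         = X≈value
    ; e≈sum           = sym (begin-equality
        1# * ℙ (λ ω → cell ω ≡ 0F) + (0# * ℙ (λ ω → cell ω ≡ 1F) + 0#)
          ≈⟨ +-cong (*-identityˡ _) (trans (+-identityʳ _) (zeroˡ _)) ⟩
        ℙ (λ ω → cell ω ≡ 0F) + 0#  ≈⟨ +-identityʳ _ ⟩
        ℙ (λ ω → cell ω ≡ 0F)       ≈⟨ ℙ-cong mA A≐ ⟨
        ℙ A                         ∎) }
    where
    cell : Ω → Fin 2
    cell ω with em {A ω}
    ... | yes _ = 0F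
    ... | no  _ = 1F

    value : Fin 2 → Carrier
    value 0F = 1#
    value 1F = 0#

    X≈value : ∀ ω → 𝟙 (A ω) ≈ value (cell ω)
    X≈value ω with em {A ω}
    ... | yes _ = refl
    ... | no  _ = refl

    A⇒ : ∀ ω → A ω → cell ω ≡ 0F
    A⇒ ω a with em {A ω}
    ... | yes _ = ≡.refl
    ... | no ¬a = contradiction a ¬a

    ¬A⇒ : ∀ ω → ¬ A ω → cell ω ≡ 1F
    ¬A⇒ ω ¬a with em {A ω}
    ... | yes a = contradiction a ¬a
    ... | no  _ = ≡.refl

    A⇐ : ∀ ω → cell ω ≡ 0F → A ω
    A⇐ ω c with em {A ω}
    ... | yes a = a
    A⇐ ω () | no _

    A≐ : A ≐ (λ ω → cell ω ≡ 0F)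
    A≐ = A⇒ _ , A⇐ _

    ∁A≐ : ∁ A ≐ (λ ω → cell ω ≡ 1F)
    ∁A≐ = ¬A⇒ _ , λ {ω} c a → contradiction (≡.trans (≡.sym c) (A⇒ ω a)) λ ()

-- Linearity of the iterated expectation.

module IteratedExpectation (em : ExcludedMiddle 0ℓ) (ℝ : CompleteOrderedField)
                           (𝒫₁ 𝒫₂ : Real.ProbabilitySpace ℝ) where
  open CompleteOrderedField ℝ
  open Real ℝ
  open ListSums em ℝ using (∑)
  private
    module P₁ = Probability em ℝ 𝒫₁
    module P₂ = Probability em ℝ 𝒫₂
    Ω₁ = ProbabilitySpace.Ω 𝒫₁
    Ω₂ = ProbabilitySpace.Ω 𝒫₂

  𝔼₂-cong : ∀ {X X′ e e′} → (∀ ω₁ ω₂ → X ω₁ ω₂ ≈ X′ ω₁ ω₂) → e ≈ e′ →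
            Expectation₂ 𝒫₁ 𝒫₂ X e → Expectation₂ 𝒫₁ 𝒫₂ X′ e′
  𝔼₂-cong X≈X′ e≈e′ (Y , E₂ , E₁) =
    Y , (λ ω₁ → P₂.𝔼-cong (X≈X′ ω₁) refl (E₂ ω₁)) , P₁.𝔼-cong (λ _ → refl) e≈e′ E₁

  𝔼₂-const : ∀ c → Expectation₂ 𝒫₁ 𝒫₂ (λ _ _ → c) c
  𝔼₂-const c = (λ _ → c) , (λ _ → P₂.𝔼-const c) , P₁.𝔼-const c

  𝔼₂-* : ∀ c {X e} → Expectation₂ 𝒫₁ 𝒫₂ X e →
         Expectation₂ 𝒫₁ 𝒫₂ (λ ω₁ ω₂ → c * X ω₁ ω₂) (c * e)
  𝔼₂-* c (Y , E₂ , E₁) = (λ ω₁ → c * Y ω₁) , (λ ω₁ → P₂.𝔼-* c (E₂ ω₁)) , P₁.𝔼-* c E₁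

  -- Linearity is applied one integral at a time: the inner means add for each fixed `ω₁`, and their
  -- sum is then integrated, so no product space is involved.
  𝔼₂-+ : ∀ {X X′ e e′} → Expectation₂ 𝒫₁ 𝒫₂ X e → Expectation₂ 𝒫₁ 𝒫₂ X′ e′ →
         Expectation₂ 𝒫₁ 𝒫₂ (λ ω₁ ω₂ → X ω₁ ω₂ + X′ ω₁ ω₂) (e + e′)
  𝔼₂-+ (Y , E₂ , E₁) (Y′ , E₂′ , E₁′) =
    (λ ω₁ → Y ω₁ + Y′ ω₁) , (λ ω₁ → P₂.𝔼-+ (E₂ ω₁) (E₂′ ω₁)) , P₁.𝔼-+ E₁ E₁′

  𝔼₂-∑ : ∀ {A : Set} (xs : List A) {X : A → Ω₁ → Ω₂ → Carrier} {e : A → Carrier} →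
         (∀ x → Expectation₂ 𝒫₁ 𝒫₂ (X x) (e x)) →
         Expectation₂ 𝒫₁ 𝒫₂ (λ ω₁ ω₂ → ∑ xs (λ x → X x ω₁ ω₂)) (∑ xs e)
  𝔼₂-∑ []       E = 𝔼₂-const 0#
  𝔼₂-∑ (x ∷ xs) E = 𝔼₂-+ (E x) (𝔼₂-∑ xs E)

2≤n⇒1≤n-1 : (em : ExcludedMiddle 0ℓ) (ℝ : CompleteOrderedField) →
            let open CompleteOrderedField ℝ in
            ∀ {n} → 2 ℕ.≤ n → 1# ≤ fromℕ n - 1#
2≤n⇒1≤n-1 em ℝ {suc (suc n)} (ℕ.s≤s (ℕ.s≤s _)) = ≤-respʳ-≈
  (solve 2 (λ x y → x :+ y := (x :+ (x :+ y)) :- x) refl 1# (fromℕ n))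
  (OrderedField.1≤fromℕ-suc em ℝ n)
  where
  open CompleteOrderedField ℝ
  open IntegerRingSolver commutativeRing

-- Collisions under the uniform random function.

module RandomFunction (em : ExcludedMiddle 0ℓ) (ℝ : CompleteOrderedField) {T : Set} {R : ℕ}
                      (2≤R : 2 ℕ.≤ R) (g : Real.UniformRandomFunction ℝ T R) where
  open CompleteOrderedField ℝ
  open OrderedField em ℝ
  open Sums ℝ
  open Indicator em ℝ
  open IntegerRingSolver commutativeRing
  open Real ℝ
  open UniformRandomFunction g
  open Probability em ℝ space
  open PartialOrderReasoning poset

  r ι : Carrier
  r = fromℕ R
  ι = 1# / r

  1≤r : 1# ≤ r
  1≤r = ≤-respʳ-≈ (solve 1 (λ r → (r :- con (+ 1)) :+ con (+ 1) := r) refl r)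
    (≤-trans (2≤n⇒1≤n-1 em ℝ 2≤R) (x≤x+y 0≤1))

  r≉0 : ¬ r ≈ 0#
  r≉0 = 1≤x⇒x≉0 1≤r

  r*ι≈1 : r * ι ≈ 1#
  r*ι≈1 = trans (*-comm _ _) (x/z*z≈x r≉0)

  Equal : T → T → Pred Ω 0ℓ
  Equal a b ω = function ω a ≡ function ω b

  measurable-Equal : ∀ a b → Measurable (Equal a b)
  measurable-Equal a b = measurable-resp
    ((λ (_ , p , q) → ≡.trans p (≡.sym q)) , λ e → _ , e , ≡.refl)
    (measurable-∃ _ (λ j → measurable-∩ (function-measurable a j) (function-measurable b j)))

  -- The common value has `R` mutually exclusive choices, each of probability `ι ^ suc m`, and the
  -- factor `r` cancels one `ι`. The cases of two and three points give all the collision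
  -- probabilities needed for second moments.
  ℙ-constant : ∀ {m} (t : Fin (suc m) → T) → Injective _≡_ _≡_ t →
               ℙ (λ ω → ∃[ j ] (∀ i → function ω (t i) ≡ j)) ≈ ι ^ m
  ℙ-constant {m} t inj = begin-equality
    ℙ (λ ω → ∃[ j ] (∀ i → function ω (t i) ≡ j))
      ≈⟨ ℙ-∃ _ (λ j → measurable-∀ _ (λ i → function-measurable (t i) j))
               (λ p q → ≡.trans (≡.sym (p 0F)) (q 0F)) ⟩
    sum {R} (λ j → ℙ (λ ω → ∀ i → function ω (t i) ≡ j))
      ≈⟨ sum-cong R (λ j → uniform t (λ _ → j) inj) ⟩
    sum {R} (λ _ → ι ^ suc m)  ≈⟨ sum-const R _ ⟩
    r * (ι * ι ^ m)            ≈⟨ *-assoc _ _ _ ⟨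
    r * ι * ι ^ m              ≈⟨ *-congʳ r*ι≈1 ⟩
    1# * ι ^ m                 ≈⟨ *-identityˡ _ ⟩
    ι ^ m                      ∎

  ℙ-Equal-≡ : ∀ {a b} → a ≡ b → ℙ (Equal a b) ≈ 1#
  ℙ-Equal-≡ a≡b = ℙ-certain (λ ω → ≡.cong (function ω) a≡b)

  ℙ-Equal-≢ : ∀ {a b} → a ≢ b → ℙ (Equal a b) ≈ ι
  ℙ-Equal-≢ {a} {b} a≢b = begin-equality
    ℙ (Equal a b)
      ≈⟨ ℙ-cong (measurable-Equal a b)
           ( (λ e → _ , λ { 0F → e ; 1F → ≡.refl })
           , λ (_ , p) → ≡.trans (p 0F) (≡.sym (p 1F)) ) ⟩
    ℙ (λ ω → ∃[ j ] (∀ i → function ω (t i) ≡ j))  ≈⟨ ℙ-constant t inj ⟩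
    ι * 1#                                         ≈⟨ *-identityʳ ι ⟩
    ι                                              ∎
    where
    t : Fin 2 → T
    t 0F = a
    t 1F = b

    inj : Injective _≡_ _≡_ t
    inj {0F} {0F} _ = ≡.refl
    inj {0F} {1F} e = contradiction e a≢b
    inj {1F} {0F} e = contradiction (≡.sym e) a≢b
    inj {1F} {1F} _ = ≡.refl

  ℙ-Equal∩Equal-≢ : ∀ {a b c} → a ≢ c → b ≢ c → a ≢ b → ℙ (Equal a c ∩ Equal b c) ≈ ι * ι
  ℙ-Equal∩Equal-≢ {a} {b} {c} a≢c b≢c a≢b = begin-equality
    ℙ (Equal a c ∩ Equal b c)
      ≈⟨ ℙ-cong (measurable-∩ (measurable-Equal a c) (measurable-Equal b c))
           ( (λ (p , q) → _ , λ { 0F → p ; 1F → q ; 2F → ≡.refl })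
           , λ (_ , p) → ≡.trans (p 0F) (≡.sym (p 2F)) , ≡.trans (p 1F) (≡.sym (p 2F)) ) ⟩
    ℙ (λ ω → ∃[ j ] (∀ i → function ω (t i) ≡ j))  ≈⟨ ℙ-constant t inj ⟩
    ι * (ι * 1#)                                   ≈⟨ *-congˡ (*-identityʳ ι) ⟩
    ι * ι                                          ∎
    where
    t : Fin 3 → T
    t 0F = a
    t 1F = b
    t 2F = c

    inj : Injective _≡_ _≡_ t
    inj {0F} {0F} _ = ≡.refl
    inj {0F} {1F} e = contradiction e a≢b
    inj {0F} {2F} e = contradiction e a≢c
    inj {1F} {0F} e = contradiction (≡.sym e) a≢b
    inj {1F} {1F} _ = ≡.refl
    inj {1F} {2F} e = contradiction e b≢c
    inj {2F} {0F} e = contradiction (≡.sym e) a≢c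
    inj {2F} {1F} e = contradiction (≡.sym e) b≢c
    inj {2F} {2F} _ = ≡.refl

  W : T → T → Ω → Carrier
  W a c ω = 𝟙 (Equal a c ω) - ι

  𝔼-W : ∀ a c → Expectation space (W a c) ((1# - ι) * 𝟙 (a ≡ c))
  𝔼-W a c = 𝔼-cong (λ _ → refl) mean (𝔼-+ (𝔼-𝟙 (measurable-Equal a c)) (𝔼-const (- ι)))
    where
    mean : ℙ (Equal a c) - ι ≈ (1# - ι) * 𝟙 (a ≡ c)
    mean with em {a ≡ c}
    ... | yes a≡c = trans (+-congʳ (ℙ-Equal-≡ a≡c)) (sym (*-identityʳ _))
    ... | no  a≢c = trans (+-congʳ (ℙ-Equal-≢ a≢c)) (trans (-‿inverseʳ ι) (sym (zeroʳ _)))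

  -- Distinct points contribute uncorrelated deviations; only a ≡ b ≢ c leaves
  -- the Bernoulli variance ι (1 - ι).
  𝔼-W*W : ∀ a b c → Expectation space (λ ω → W a c ω * W b c ω)
            ((1# - ι) * (1# - ι) * 𝟙 (a ≡ c × b ≡ c) + ι * (1# - ι) * 𝟙 (¬ a ≡ c × a ≡ b))
  𝔼-W*W a b c = 𝔼-cong expand mean
    (𝔼-+ (𝔼-+ (𝔼-𝟙 (measurable-∩ mA mB)) (𝔼-* (- ι) (𝔼-+ (𝔼-𝟙 mA) (𝔼-𝟙 mB)))) (𝔼-const (ι * ι)))
    where
    A B : Pred Ω 0ℓ
    A = Equal a c
    B = Equal b c

    mA : Measurable A
    mA = measurable-Equal a c
    mB : Measurable B
    mB = measurable-Equal b c

    expand : ∀ ω → 𝟙 ((A ∩ B) ω) + - ι * (𝟙 (A ω) + 𝟙 (B ω)) + ι * ι ≈ W a c ω * W b c ω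
    expand ω = trans (+-congʳ (+-congʳ 𝟙-×))
      (solve 3 (λ x y i → x :* y :+ :- i :* (x :+ y) :+ i :* i := (x :- i) :* (y :- i))
        refl (𝟙 (A ω)) (𝟙 (B ω)) ι)

    -- Each coincidence pattern of `a`, `b`, `c` fixes three probabilities and two indicators; what
    -- remains is a polynomial identity in `ι`.
    from : ∀ {u v w x y} → ℙ (A ∩ B) ≈ u → ℙ A ≈ v → ℙ B ≈ w →
           𝟙 (a ≡ c × b ≡ c) ≈ x → 𝟙 (¬ a ≡ c × a ≡ b) ≈ y →
           u + - ι * (v + w) + ι * ι ≈ (1# - ι) * (1# - ι) * x + ι * (1# - ι) * y →
           ℙ (A ∩ B) + - ι * (ℙ A + ℙ B) + ι * ι ≈
             (1# - ι) * (1# - ι) * 𝟙 (a ≡ c × b ≡ c) + ι * (1# - ι) * 𝟙 (¬ a ≡ c × a ≡ b)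
    from u v w x y eq = trans (+-congʳ (+-cong u (*-congˡ (+-cong v w))))
      (trans eq (sym (+-cong (*-congˡ x) (*-congˡ y))))

    mean : ℙ (A ∩ B) + - ι * (ℙ A + ℙ B) + ι * ι ≈
             (1# - ι) * (1# - ι) * 𝟙 (a ≡ c × b ≡ c) + ι * (1# - ι) * 𝟙 (¬ a ≡ c × a ≡ b)
    mean with em {a ≡ c} | em {b ≡ c} | em {a ≡ b}
    ... | yes ≡.refl | yes ≡.refl | _ =
      from (ℙ-certain (λ _ → ≡.refl , ≡.refl)) (ℙ-Equal-≡ ≡.refl) (ℙ-Equal-≡ ≡.refl)
           (𝟙-yes (≡.refl , ≡.refl)) (𝟙-no (λ (a≢a , _) → a≢a ≡.refl))
        (solve 1 (λ i → con (+ 1) :+ :- i :* (con (+ 1) :+ con (+ 1)) :+ i :* i :=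
          (con (+ 1) :- i) :* (con (+ 1) :- i) :* con (+ 1) :+ i :* (con (+ 1) :- i) :* con +0) refl ι)
    -- Here `W a c` is constantly `1# - ι` while `W b c` has mean zero; the next case is symmetric.
    ... | yes ≡.refl | no b≢c | _ =
      from (trans (ℙ-cong (measurable-∩ mA mB) (proj₂ , (≡.refl ,_))) (ℙ-Equal-≢ b≢c))
           (ℙ-Equal-≡ ≡.refl) (ℙ-Equal-≢ b≢c)
           (𝟙-no (b≢c ∘ proj₂)) (𝟙-no (λ (a≢a , _) → a≢a ≡.refl))
        (solve 1 (λ i → i :+ :- i :* (con (+ 1) :+ i) :+ i :* i :=
          (con (+ 1) :- i) :* (con (+ 1) :- i) :* con +0 :+ i :* (con (+ 1) :- i) :* con +0) refl ι)
    ... | no a≢c | yes ≡.refl | _ =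
      from (trans (ℙ-cong (measurable-∩ mA mB) (proj₁ , (_, ≡.refl))) (ℙ-Equal-≢ a≢c))
           (ℙ-Equal-≢ a≢c) (ℙ-Equal-≡ ≡.refl)
           (𝟙-no (a≢c ∘ proj₁)) (𝟙-no (a≢c ∘ proj₂))
        (solve 1 (λ i → i :+ :- i :* (i :+ con (+ 1)) :+ i :* i :=
          (con (+ 1) :- i) :* (con (+ 1) :- i) :* con +0 :+ i :* (con (+ 1) :- i) :* con +0) refl ι)
    ... | no a≢c | no b≢c | yes ≡.refl =
      from (trans (ℙ-cong (measurable-∩ mA mB) (proj₁ , λ p → p , p)) (ℙ-Equal-≢ a≢c))
           (ℙ-Equal-≢ a≢c) (ℙ-Equal-≢ b≢c)
           (𝟙-no (a≢c ∘ proj₁)) (𝟙-yes (a≢c , ≡.refl))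
        (solve 1 (λ i → i :+ :- i :* (i :+ i) :+ i :* i :=
          (con (+ 1) :- i) :* (con (+ 1) :- i) :* con +0 :+ i :* (con (+ 1) :- i) :* con (+ 1)) refl ι)
    -- For three distinct points the collisions with `c` are independent: the joint probability
    -- `ι * ι` is the product of the two single ones.
    ... | no a≢c | no b≢c | no a≢b =
      from (ℙ-Equal∩Equal-≢ a≢c b≢c a≢b) (ℙ-Equal-≢ a≢c) (ℙ-Equal-≢ b≢c)
           (𝟙-no (a≢c ∘ proj₁)) (𝟙-no (a≢b ∘ proj₂))
        (solve 1 (λ i → i :* i :+ :- i :* (i :+ i) :+ i :* i :=
          (con (+ 1) :- i) :* (con (+ 1) :- i) :* con +0 :+ i :* (con (+ 1) :- i) :* con +0) refl ι)

-- Collisions under concatenated draws.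

module Draws (em : ExcludedMiddle 0ℓ) (ℝ : CompleteOrderedField) {d : ℕ} {S : Set}
             (ℋ : Real.LSHFamily ℝ d S) {p : ℕ} (h : Real.IndependentDraws ℝ ℋ p) where
  open CompleteOrderedField ℝ
  open OrderedField em ℝ
  open Real ℝ
  private module ℋ = LSHFamily ℋ
  open IndependentDraws h
  open Probability em ℝ space
  open MonoidSum *-monoid using () renaming (sum-cong-≋ to product-cong; sum-replicate to product-replicate)

  Collide : Point d → Point d → Pred Ω 0ℓ
  Collide x y ω = concatenation ω x ≡ concatenation ω y

  private
    AllCollide : Point d → Point d → Pred Ω 0ℓ
    AllCollide x y ω = ∀ i → ℋ.Collision x y (draw i ω)

    Collide≐ : ∀ x y → AllCollide x y ≐ Collide x y
    Collide≐ x y = tabulate-cong , λ {ω} e i →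
      ≡.trans (≡.sym (lookup∘tabulate (λ i → ℋ.hash (draw i ω) ⟨$⟩ x) i))
        (≡.trans (≡.cong (λ v → Vec.lookup v i) e) (lookup∘tabulate (λ i → ℋ.hash (draw i ω) ⟨$⟩ y) i))

    measurable-AllCollide : ∀ x y → Measurable (AllCollide x y)
    measurable-AllCollide x y = measurable-∀ _ (λ i → draw-measurable i (ℋ.collision-measurable x y))

  measurable-Collide : ∀ x y → Measurable (Collide x y)
  measurable-Collide x y = measurable-resp (Collide≐ x y) (measurable-AllCollide x y)

  -- Concatenations agree exactly when all `p` draws collide, and independence splits this event
  -- into `p` factors of the same law.
  ℙ-Collide : ∀ x y → ℙ (Collide x y) ≈ ℋ.k x y ^ p
  ℙ-Collide x y =
    trans (sym (ℙ-cong (measurable-AllCollide x y) (Collide≐ x y)))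
    (trans (independent (λ _ → ℋ.Collision x y) (λ _ → ℋ.collision-measurable x y))
    (trans (product-cong {p} (λ i → draw-law i (ℋ.collision-measurable x y)))
           (product-replicate p)))

  k-nonneg : ∀ x y → 0# ≤ ℋ.k x y
  k-nonneg x y = ProbabilitySpace.ℙ-nonneg ℋ.space (ℋ.collision-measurable x y)

  -- ℙ(A ∩ B)² ≤ ℙ(A) ℙ(B) by monotonicity alone.
  ℙ-Collide∩Collide : ∀ x y q →
    ℙ (Collide x q ∩ Collide y q) ≤ √ (ℋ.k x q) ^ p * √ (ℋ.k y q) ^ p
  ℙ-Collide∩Collide x y q = x*x≤y*y⇒x≤y (*-nonneg (κ-nonneg x) (κ-nonneg y)) (begin
    ℙ (A ∩ B) * ℙ (A ∩ B)
      ≤⟨ *-mono-≤ (ℙ-nonneg mA) (ℙ-nonneg mAB) (ℙ-mono mAB mA proj₁) (ℙ-mono mAB mB proj₂) ⟩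
    ℙ A * ℙ B                  ≈⟨ *-cong (ℙ-Collide x q) (ℙ-Collide y q) ⟩
    ℋ.k x q ^ p * ℋ.k y q ^ p  ≈⟨ *-cong (^-square p (√*√≈ (k-nonneg x q))) (^-square p (√*√≈ (k-nonneg y q))) ⟨
    κ x * κ x * (κ y * κ y)
      ≈⟨ solve 2 (λ u v → u :* u :* (v :* v) := u :* v :* (u :* v)) refl (κ x) (κ y) ⟩
    κ x * κ y * (κ x * κ y)    ∎)
    where
    open IntegerRingSolver commutativeRing
    open PartialOrderReasoning poset
    A B : Pred Ω 0ℓ
    A = Collide x q
    B = Collide y q
    mA : Measurable A
    mA = measurable-Collide x q
    mB : Measurable B
    mB = measurable-Collide y q
    mAB : Measurable (A ∩ B)
    mAB = measurable-∩ mA mB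
    κ : Point d → Carrier
    κ x = √ (ℋ.k x q) ^ p
    κ-nonneg : ∀ x → 0# ≤ κ x
    κ-nonneg x = ^-nonneg p (√-nonneg _)

-- Moments of the estimator and the variance bound.

module Moments (em : ExcludedMiddle 0ℓ) (ℝ : CompleteOrderedField) {d : ℕ} {S : Set}
               (ℋ : Real.LSHFamily ℝ d S) {p R : ℕ} (2≤R : 2 ℕ.≤ R)
               (h : Real.IndependentDraws ℝ ℋ p)
               (g : Real.UniformRandomFunction ℝ (Vec S p) R)
               (D : List (Real.Point ℝ d)) (D≢[] : D ≢ []) (q : Real.Point ℝ d) where
  open CompleteOrderedField ℝ
  open OrderedField em ℝ
  open IntegerRingSolver commutativeRing
  open Indicator em ℝ
  open ListSums em ℝ
  open Real ℝ
  open LSHFamily ℋ using (k)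
  open IndependentDraws h using (concatenation; ℙ) renaming (space to 𝒫ʰ)
  open UniformRandomFunction g using () renaming (space to 𝒫ᵍ)
  open Estimator ℋ h g D hiding (r)
  open Draws em ℝ ℋ h
  open RandomFunction em ℝ 2≤R g
  open IteratedExpectation em ℝ 𝒫ʰ 𝒫ᵍ
  private module Pʰ = Probability em ℝ 𝒫ʰ
  open ProbabilitySpace 𝒫ʰ using () renaming (Ω to Ωʰ; Measurable to Measurableʰ)
  open ProbabilitySpace 𝒫ᵍ using () renaming (Ω to Ωᵍ)
  open PartialOrderReasoning poset

  -- Hashing by `g` shrinks the mean of a deviation by `s`; `σ` is the inverse of `s`, and `c` is
  -- the coefficient of the summed deviations in `K̂`.
  s σ n c : Carrier
  s = 1# - ι
  σ = r / (r - 1#)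
  n = 1# / N
  c = n * σ

  r-1≉0 : ¬ r - 1# ≈ 0#
  r-1≉0 = 1≤x⇒x≉0 (2≤n⇒1≤n-1 em ℝ 2≤R)

  N≉0 : ¬ N ≈ 0#
  N≉0 = nonempty D D≢[]
    where
    nonempty : ∀ D → D ≢ [] → ¬ fromℕ (length D) ≈ 0#
    nonempty []      D≢[] = contradiction ≡.refl D≢[]
    nonempty (_ ∷ D) _    = 1≤x⇒x≉0 (1≤fromℕ-suc (length D))

  n*N≈1 : n * N ≈ 1#
  n*N≈1 = x/z*z≈x N≉0

  s≈[r-1]/r : s ≈ (r - 1#) / r
  s≈[r-1]/r = *-cancelʳ r≉0 (begin-equality
    (1# - ι) * r        ≈⟨ solve 2 (λ i r → (con (+ 1) :- i) :* r := r :- i :* r) refl ι r ⟩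
    r - ι * r           ≈⟨ +-congˡ (-‿cong (x/z*z≈x r≉0)) ⟩
    r - 1#              ≈⟨ x/z*z≈x r≉0 ⟨
    (r - 1#) / r * r    ∎)

  σ*s≈1 : σ * s ≈ 1#
  σ*s≈1 = begin-equality
    r * (r - 1#) ⁻¹ * s               ≈⟨ *-congˡ s≈[r-1]/r ⟩
    r * (r - 1#) ⁻¹ * ((r - 1#) / r)
      ≈⟨ solve 4 (λ r i t j → r :* i :* (t :* j) := (t :* i) :* (r :* j)) refl r ((r - 1#) ⁻¹) (r - 1#) (r ⁻¹) ⟩
    (r - 1#) / (r - 1#) * (r / r)     ≈⟨ *-cong (*-inverseʳ _ r-1≉0) (*-inverseʳ r r≉0) ⟩
    1# * 1#                           ≈⟨ *-identityˡ 1# ⟩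
    1#                                ∎

  0≤ι : 0# ≤ ι
  0≤ι = *-nonneg 0≤1 (⁻¹-nonneg (1≤x⇒0≤x 1≤r) r≉0)

  0≤s : 0# ≤ s
  0≤s = *-cancelʳ-nonneg 1≤r (≤-respʳ-≈ (sym (trans (*-congʳ s≈[r-1]/r) (x/z*z≈x r≉0)))
    (x≤y⇒0≤y-x 1≤r))

  s≤1 : s ≤ 1#
  s≤1 = 0≤y-x⇒x≤y (≤-respʳ-≈ (solve 1 (λ i → i := con (+ 1) :- (con (+ 1) :- i)) refl ι) 0≤ι)

  V : Point d → Ωʰ → Ωᵍ → Carrier
  V x ω₁ = W (concatenation ω₁ x) (concatenation ω₁ q)

  K̂≈ : ∀ ω₁ ω₂ → K̂ q ω₁ ω₂ ≈ c * ∑ D (λ x → V x ω₁ ω₂)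
  K̂≈ ω₁ ω₂ = begin-equality
    (fromℕ (A ω₁ ω₂ (h̄ ω₁ ω₂ q)) / N - ι) * σ
      ≈⟨ *-congʳ (+-congʳ (*-congʳ (fromℕ-length-filter _ D))) ⟩
    (Z * N ⁻¹ - ι) * σ
      -- Writing `ι` as `n * N * ι` distributes the correction over the data, one `ι` for each
      -- point.
      ≈⟨ *-congʳ (+-cong (solve 2 (λ z m → z :* m := con (+ 1) :* m :* z) refl Z (N ⁻¹))
                         (-‿cong (trans (sym (*-identityˡ ι)) (*-congʳ (sym n*N≈1))))) ⟩
    (n * Z - n * N * ι) * σ
      ≈⟨ solve 5 (λ n z m i t → (n :* z :- n :* m :* i) :* t := n :* t :* (z :+ m :* :- i)) refl n Z N ι σ ⟩
    c * (Z + N * - ι)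
      ≈⟨ *-congˡ (trans (∑-+ D _ _) (+-congˡ (∑-const D _))) ⟨
    c * ∑ D (λ x → V x ω₁ ω₂) ∎
    where
    Z : Carrier
    Z = ∑ D (λ x → 𝟙 (h̄ ω₁ ω₂ x ≡ h̄ ω₁ ω₂ q))

  K̂*K̂≈ : ∀ ω₁ ω₂ → c * c * ∑ D (λ x → ∑ D (λ y → V x ω₁ ω₂ * V y ω₁ ω₂)) ≈ K̂ q ω₁ ω₂ * K̂ q ω₁ ω₂
  K̂*K̂≈ ω₁ ω₂ = begin-equality
    c * c * ∑ D (λ x → ∑ D (λ y → V x ω₁ ω₂ * V y ω₁ ω₂))
      ≈⟨ *-congˡ (∑-*-∑ D _ D _) ⟨
    c * c * (v * v)
      ≈⟨ solve 2 (λ c v → c :* c :* (v :* v) := c :* v :* (c :* v)) refl c v ⟩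
    c * v * (c * v)
      ≈⟨ *-cong (K̂≈ ω₁ ω₂) (K̂≈ ω₁ ω₂) ⟨
    K̂ q ω₁ ω₂ * K̂ q ω₁ ω₂ ∎
    where
    v : Carrier
    v = ∑ D (λ x → V x ω₁ ω₂)

  -- As a function of `ω₁`, the inner mean is `s` times the indicator of a measurable collision
  -- event, so the outer integral is a probability.
  𝔼-V : ∀ x → 𝔼 (V x) (s * ℙ (Collide x q))
  𝔼-V x = _ , (λ ω₁ → 𝔼-W (concatenation ω₁ x) (concatenation ω₁ q))
            , Pʰ.𝔼-* s (Pʰ.𝔼-𝟙 (measurable-Collide x q))

  -- This is the mixed second moment of `V x` and `V y`, not centred at their means; the squared
  -- mean is subtracted only once, for the whole estimator.
  covariance : Point d → Point d → Carrier
  covariance x y = s * s * ℙ (Collide x q ∩ Collide y q) + ι * s * ℙ (∁ (Collide x q) ∩ Collide x y)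

  measurable-both : ∀ x y → Measurableʰ (Collide x q ∩ Collide y q)
  measurable-both x y = Pʰ.measurable-∩ (measurable-Collide x q) (measurable-Collide y q)

  -- Once `x` and `y` collide, both miss `q` or neither does, so testing `x` alone suffices.
  measurable-neither : ∀ x y → Measurableʰ (∁ (Collide x q) ∩ Collide x y)
  measurable-neither x y = Pʰ.measurable-∩
    (ProbabilitySpace.measurable-∁ 𝒫ʰ (measurable-Collide x q)) (measurable-Collide x y)

  𝔼-V*V : ∀ x y → 𝔼 (λ ω₁ ω₂ → V x ω₁ ω₂ * V y ω₁ ω₂) (covariance x y)
  𝔼-V*V x y =
    _ , (λ ω₁ → 𝔼-W*W (concatenation ω₁ x) (concatenation ω₁ y) (concatenation ω₁ q))
      , Pʰ.𝔼-+ (Pʰ.𝔼-* (s * s) (Pʰ.𝔼-𝟙 (measurable-both x y)))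
               (Pʰ.𝔼-* (ι * s) (Pʰ.𝔼-𝟙 (measurable-neither x y)))

  μ M : Carrier
  μ = K q
  M = c * c * ∑ D (λ x → ∑ D (covariance x))

  mean : 𝔼 (K̂ q) μ
  mean = 𝔼₂-cong (λ ω₁ ω₂ → sym (K̂≈ ω₁ ω₂)) value (𝔼₂-* c (𝔼₂-∑ D 𝔼-V))
    where
    value : c * ∑ D (λ x → s * ℙ (Collide x q)) ≈ n * ∑ D (λ x → k x q ^ p)
    value = begin-equality
      n * σ * ∑ D (λ x → s * ℙ (Collide x q))    ≈⟨ *-congˡ (∑-*ˡ D s _) ⟩
      n * σ * (s * ∑ D (λ x → ℙ (Collide x q)))  ≈⟨ *-congˡ (*-congˡ (∑-cong D (λ x → ℙ-Collide x q))) ⟩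
      n * σ * (s * ∑ D (λ x → k x q ^ p))
        ≈⟨ solve 4 (λ n t s e → n :* t :* (s :* e) := n :* (t :* s :* e)) refl n σ s _ ⟩
      -- The scaling `r / (r - 1#)` in the estimator is chosen for this cancellation.
      n * (σ * s * ∑ D (λ x → k x q ^ p))        ≈⟨ *-congˡ (trans (*-congʳ σ*s≈1) (*-identityˡ _)) ⟩
      n * ∑ D (λ x → k x q ^ p)                  ∎

  second-moment : 𝔼 (λ ω₁ ω₂ → K̂ q ω₁ ω₂ * K̂ q ω₁ ω₂) M
  second-moment = 𝔼₂-cong K̂*K̂≈ refl (𝔼₂-* (c * c) (𝔼₂-∑ D (λ x → 𝔼₂-∑ D (𝔼-V*V x))))

  -- Expanding the square around `μ` leaves only the second moment, the mean and a constant, to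
  -- which linearity applies.
  variance : 𝕍ar (K̂ q) (M - μ * μ)
  variance = μ , mean , 𝔼₂-cong
    (λ ω₁ ω₂ → sym (trans (^2≈ _)
      (solve 2 (λ x m → (x :- m) :* (x :- m) := x :* x :+ :- (m :+ m) :* x :+ m :* m) refl (K̂ q ω₁ ω₂) μ)))
    (solve 2 (λ v m → v :+ :- (m :+ m) :* m :+ m :* m := v :- m :* m) refl M μ)
    (𝔼₂-+ (𝔼₂-+ second-moment (𝔼₂-* (- (μ + μ)) mean)) (𝔼₂-const (μ * μ)))

  κ : Point d → Carrier
  κ x = √ (k x q) ^ p

  -- One factor `s` is given away in each term through `s ≤ 1#`, leaving the coefficients of the
  -- target: `√ ((r - 1#) / r)` squares to `s`, and `1# / √ r` squares to `ι`.
  covariance≤ : ∀ x y → covariance x y ≤ s * (κ x * κ y) + ι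
  covariance≤ x y = +-mono-≤
    (*-mono-≤ 0≤s (ProbabilitySpace.ℙ-nonneg 𝒫ʰ (measurable-both x y))
      (≤-respʳ-≈ (*-identityʳ s) (*-monoʳ-≤ 0≤s s≤1)) (ℙ-Collide∩Collide x y q))
    (begin
      ι * s * ℙ (∁ (Collide x q) ∩ Collide x y)
        ≤⟨ *-mono-≤ 0≤ι (ProbabilitySpace.ℙ-nonneg 𝒫ʰ (measurable-neither x y))
             (≤-respʳ-≈ (*-identityʳ ι) (*-monoʳ-≤ 0≤ι s≤1)) (Pʰ.ℙ≤1 (measurable-neither x y)) ⟩
      ι * 1#  ≈⟨ *-identityʳ ι ⟩
      ι       ∎)

  bound : M - μ * μ ≤ σ ^ 2 * (√ ((r - 1#) / r) * K̃ q + 1# / √ r) ^ 2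
  bound = begin
    M - μ * μ
      ≤⟨ 0≤y-x⇒x≤y (≤-respʳ-≈ (solve 2 (λ v m → m :* m := v :- (v :- m :* m)) refl M μ) (x*x-nonneg μ)) ⟩
    M
      ≤⟨ *-monoʳ-≤ (x*x-nonneg c) (∑-mono D (λ x → ∑-mono D (covariance≤ x))) ⟩
    c * c * ∑ D (λ x → ∑ D (λ y → s * (κ x * κ y) + ι))
      ≈⟨ *-congˡ sums ⟩
    c * c * (s * (T * T) + N * (N * ι))
      -- The two factors `n` are shared out: `n * T` is `K̃ q` by definition, and the `N * N` copies
      -- of `ι`, one for each ordered pair, average to a single one.
      ≈⟨ solve 6 (λ n t s e m i → n :* t :* (n :* t) :* (s :* (e :* e) :+ m :* (m :* i)) :=
                    t :* t :* (s :* (n :* e :* (n :* e)) :+ (n :* m) :* (n :* m) :* i))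
           refl n σ s T N ι ⟩
    σ * σ * (s * (K̃ q * K̃ q) + n * N * (n * N) * ι)
      ≈⟨ *-congˡ (+-cong (*-congʳ (sym a*a≈s))
           (trans (trans (*-congʳ (trans (*-cong n*N≈1 n*N≈1) (*-identityˡ 1#))) (*-identityˡ ι)) (sym b*b≈ι))) ⟩
    σ * σ * (a * a * (K̃ q * K̃ q) + b * b)
      ≤⟨ *-monoʳ-≤ (x*x-nonneg σ) (x≤x+y (+-nonneg 0≤aK̃b 0≤aK̃b)) ⟩
    σ * σ * (a * a * (K̃ q * K̃ q) + b * b + (a * K̃ q * b + a * K̃ q * b))
      ≈⟨ solve 4 (λ t a e b → t :* t :* (a :* a :* (e :* e) :+ b :* b :+ (a :* e :* b :+ a :* e :* b)) :=
                    t :* t :* ((a :* e :+ b) :* (a :* e :+ b))) refl σ a (K̃ q) b ⟩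
    σ * σ * ((a * K̃ q + b) * (a * K̃ q + b))
      ≈⟨ *-cong (^2≈ σ) (^2≈ _) ⟨
    σ ^ 2 * (a * K̃ q + b) ^ 2 ∎
    where
    a b T : Carrier
    a = √ ((r - 1#) / r)
    b = 1# / √ r
    T = ∑ D κ

    sums : ∑ D (λ x → ∑ D (λ y → s * (κ x * κ y) + ι)) ≈ s * (T * T) + N * (N * ι)
    sums = begin-equality
      ∑ D (λ x → ∑ D (λ y → s * (κ x * κ y) + ι))
        ≈⟨ ∑-cong D (λ x → trans (∑-+ D _ _) (+-cong (∑-*ˡ D s _) (∑-const D ι))) ⟩
      ∑ D (λ x → s * ∑ D (λ y → κ x * κ y) + N * ι)
        ≈⟨ trans (∑-+ D _ _) (+-cong (∑-*ˡ D s _) (∑-const D _)) ⟩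
      s * ∑ D (λ x → ∑ D (λ y → κ x * κ y)) + N * (N * ι)
        ≈⟨ +-congʳ (*-congˡ (∑-*-∑ D κ D κ)) ⟨
      s * (T * T) + N * (N * ι) ∎

    a*a≈s : a * a ≈ s
    a*a≈s = trans (√*√≈ (≤-respʳ-≈ s≈[r-1]/r 0≤s)) (sym s≈[r-1]/r)

    √r≉0 : ¬ √ r ≈ 0#
    √r≉0 √r≈0 = r≉0 (trans (sym (√*√≈ (1≤x⇒0≤x 1≤r))) (trans (*-congʳ √r≈0) (zeroˡ _)))

    b*b≈ι : b * b ≈ ι
    b*b≈ι = *-cancelʳ r≉0 (begin-equality
      b * b * r              ≈⟨ *-congˡ (√*√≈ (1≤x⇒0≤x 1≤r)) ⟨
      b * b * (√ r * √ r)    ≈⟨ solve 2 (λ b w → b :* b :* (w :* w) := b :* w :* (b :* w)) refl b (√ r) ⟩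
      b * √ r * (b * √ r)    ≈⟨ *-cong (x/z*z≈x √r≉0) (x/z*z≈x √r≉0) ⟩
      1# * 1#                ≈⟨ *-identityˡ 1# ⟩
      1#                     ≈⟨ x/z*z≈x r≉0 ⟨
      ι * r                  ∎)

    0≤b : 0# ≤ b
    0≤b = *-nonneg 0≤1 (⁻¹-nonneg (√-nonneg r) √r≉0)

    0≤T : ∀ D → 0# ≤ ∑ D κ
    0≤T []      = ≤-refl
    0≤T (x ∷ D) = +-nonneg (^-nonneg p (√-nonneg _)) (0≤T D)

    0≤n : 0# ≤ n
    0≤n = *-nonneg 0≤1 (⁻¹-nonneg (fromℕ-nonneg (length D)) N≉0)

    0≤aK̃b : 0# ≤ a * K̃ q * b
    0≤aK̃b = *-nonneg (*-nonneg (√-nonneg _) (*-nonneg 0≤n (0≤T D))) 0≤b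

mainTheorem2 :
    ExcludedMiddle 0ℓ →
    (ℝ : CompleteOrderedField) →
    let open CompleteOrderedField ℝ
        open Real ℝ in
    (d : ℕ) (S : Set) (ℋ : LSHFamily d S)
    (p R : ℕ) → 1 ℕ.≤ p → 2 ℕ.≤ R →
    (h : IndependentDraws ℋ p)
    (g : UniformRandomFunction (Vec S p) R)
    (D : List (Point d)) → Unique (pointSetoid d) D → D ≢ [] →
    (q : Point d) →
    let open Estimator ℋ h g D in
    𝔼 (K̂ q) (K q) ×
    (∃[ v ] 𝕍ar (K̂ q) v ×
            v ≤ (r / (r - 1#)) ^ 2 * (√ ((r - 1#) / r) * K̃ q + 1# / √ r) ^ 2)
mainTheorem2 em ℝ d S ℋ p R _ 2≤R h g D _ D≢[] q = mean , _ , variance , bound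
  where open Moments em ℝ ℋ 2≤R h g D D≢[] q
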